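{- Let $\Psi$ be an unsatisfiable $(2,k)$-CSP with variable frequency at most $r$ on $m$ variables. If $r$ is fixed and $k \in o(\sqrt m)$, then there exists a tree-like resolution refutation of the CNF representation of $\Psi$ of size $2^{(1-\epsilon_r)m + o(m)}$, where $\epsilon_r = (1 - 2^{ -1/r})^r$.
   Context: A $(2,k)$-CSP $\Psi = (X,\mathcal{C})$ consists of a finite set $X$ of Boolean variables and a finite set $\mathcal{C}$ of constraints, each on at most $k$ of the variables. An assignment satisfies $\Psi$ if it satisfies every constraint. The variable frequency of $\Psi$ is the largest number of constraints that any variable appears in. The CNF representation of $\Psi$ is the $k$-CNF obtained by writing each constraint as a CNF over its own variables: for each assignment to the variables of the constraint that violates it, there is the clause on these variables falsified exactly by that assignment (so a $(2,k)$-CSP with $n$ constraints gives at most $n2^k$ clauses). A tree-like resolution refutation is a resolution refutation whose underlying derivation graph is a tree. Its smallest size equals the smallest size of a decision tree for the CNF, i.e. a rooted binary tree whose inner nodes are labeled by variables, whose edges are labeled by $0/1$ (the value of the variable queried at the node they come out of), and whose leaves are labeled by clauses falsified by the partial assignment along the path from the root to the leaf. Asymptotic notation is as $m\to\infty$ with $r$ fixed and $k = k(m) = o(\sqrt m)$; the $o(m)$ term depends on $r$ and on the function $k(m)$, but not on the particular $\Psi$. -}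

module Defs where

open import Algebra.Definitions.RawSemiring as Power using ()
open import Data.Bool using (Bool; true; false; not) renaming (_≟_ to _≟ᵇ_)
open import Data.Fin using (Fin)
open import Data.Fin.Subset using (Subset; inside; outside; ∣_∣; _∪_; _-_) renaming (_∈_ to _∈ˢ_; ⊥ to ∅)
open import Data.Fin.Subset.Properties using (_∈?_)
open import Data.Integer using (ℤ; +_; -[1+_])
open import Data.List using (List; []; _∷_; length; filter; map; concatMap; cartesianProductWith; allFin)
open import Data.List.Extrema.Nat using (max)
open import Data.List.Membership.Propositional using (_∈_)
open import Data.List.Relation.Unary.All using (All)
open import Data.Nat as ℕ using (ℕ; zero; suc; NonZero)
open import Data.Product using (∃-syntax; _×_)
open import Data.Rational as ℚ using (ℚ; 0ℚ; 1ℚ; ½; _<_; _⊓_; _⊔_; ↥_; ↧ₙ_)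
open import Data.Sum using (_⊎_)
open import Data.Vec using (Vec; []; _∷_)
open import Relation.Binary.PropositionalEquality using (_≡_)
open import Relation.Nullary using (¬_)

------------------------------------------------------------------------
-- Real numbers

-- A real is given by the rationals strictly below it and those strictly above
-- it (a two-sided Dedekind cut).  The cut axioms are not carried as fields;
-- every operation below is the usual one on Dedekind cuts.
record ℝ : Set₁ where
  field
    L U : ℚ → Set

open ℝ public

infix  4 _≤ᴿ_
infixl 6 _+ᴿ_ _-ᴿ_
infixl 7 _*ᴿ_
infixr 8 _^ᴿ_ _^ℚ_
infix  9 2^_

_≤ᴿ_ : ℝ → ℝ → Set
x ≤ᴿ y = ∀ q → U y q → U x q

fromℚ : ℚ → ℝ
fromℚ p .L q = q < p
fromℚ p .U q = p < q

fromℕ : ℕ → ℝ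
fromℕ n = fromℚ (+ n ℚ./ 1)

_+ᴿ_ : ℝ → ℝ → ℝ
(x +ᴿ y) .L q = ∃[ a ] ∃[ c ] (L x a × L y c × q ≡ a ℚ.+ c)
(x +ᴿ y) .U q = ∃[ b ] ∃[ d ] (U x b × U y d × q ≡ b ℚ.+ d)

-ᴿ_ : ℝ → ℝ
(-ᴿ x) .L q = U x (ℚ.- q)
(-ᴿ x) .U q = L x (ℚ.- q)

_-ᴿ_ : ℝ → ℝ → ℝ
x -ᴿ y = x +ᴿ (-ᴿ y)

-- Interval multiplication: if a < x < b and c < y < d, then x y lies between
-- the least and the greatest of the four products of endpoints.
_*ᴿ_ : ℝ → ℝ → ℝ
(x *ᴿ y) .L q = ∃[ a ] ∃[ b ] ∃[ c ] ∃[ d ] (L x a × U x b × L y c × U y d ×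
  q < ((a ℚ.* c) ⊓ (a ℚ.* d)) ⊓ ((b ℚ.* c) ⊓ (b ℚ.* d)))
(x *ᴿ y) .U q = ∃[ a ] ∃[ b ] ∃[ c ] ∃[ d ] (L x a × U x b × L y c × U y d ×
  ((a ℚ.* c) ⊔ (a ℚ.* d)) ⊔ ((b ℚ.* c) ⊔ (b ℚ.* d)) < q)

_^ᴿ_ : ℝ → ℕ → ℝ
x ^ᴿ zero  = fromℚ 1ℚ
x ^ᴿ suc n = x *ᴿ x ^ᴿ n

_^ℚ_ : ℚ → ℕ → ℚ
_^ℚ_ = Power._^_ ℚ.+-*-rawSemiring

-- The nonnegative n-th root of a rational p ≥ 0.
root : (n : ℕ) .{{_ : NonZero n}} → ℚ → ℝ
root n p .L q = q < 0ℚ ⊎ q ^ℚ n < p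
root n p .U q = 0ℚ < q × p < q ^ℚ n

√_ : ℕ → ℝ
√ m = root 2 (+ m ℚ./ 1)

2^ℤ_ : ℤ → ℚ
2^ℤ (+ n)    = (+ 2 ℚ./ 1) ^ℚ n
2^ℤ -[1+ n ] = ½ ^ℚ suc n

2^ℚ_ : ℚ → ℝ
2^ℚ q = root (↧ₙ q) (2^ℤ (↥ q))

-- Extended from rational to real exponents by monotonicity and continuity.
2^_ : ℝ → ℝ
(2^ x) .L t = ∃[ q ] (L x q × L (2^ℚ q) t)
(2^ x) .U t = ∃[ q ] (U x q × U (2^ℚ q) t)

ε : (r : ℕ) .{{_ : NonZero r}} → ℝ
ε r = (fromℕ 1 -ᴿ 2^ (-ᴿ fromℚ (+ 1 ℚ./ r))) ^ᴿ r

-- f(m) = o(g(m)) as m → ∞, for nonnegative g.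
infix 4 _∈o_
_∈o_ : (ℕ → ℕ) → (ℕ → ℝ) → Set
f ∈o g = ∀ c → ∃[ M ] (∀ m → M ℕ.≤ m → fromℕ (c ℕ.* f m) ≤ᴿ g m)

------------------------------------------------------------------------
-- Clauses and CNFs on m variables

-- A clause is a set of literals: the variables occurring positively and those
-- occurring negatively.
record Clause (m : ℕ) : Set where
  constructor clause
  field
    pos neg : Subset m

open Clause public

CNF : ℕ → Set
CNF m = List (Clause m)

emptyClause : ∀ {m} → Clause m
emptyClause = clause ∅ ∅

------------------------------------------------------------------------
-- Tree-like resolution

resolvent : ∀ {m} → Fin m → Clause m → Clause m → Clause m
resolvent x C D = clause ((pos C - x) ∪ pos D) (neg C ∪ (neg D - x))

-- Elements are derivations in tree form: a clause used several times is
-- derived anew each time.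
infix 3 _⊢_
data _⊢_ {m} (F : CNF m) : Clause m → Set where
  axiom   : ∀ {C} → C ∈ F → F ⊢ C
  resolve : ∀ {C D} (x : Fin m) → x ∈ˢ pos C → x ∈ˢ neg D →
            F ⊢ C → F ⊢ D → F ⊢ resolvent x C D

TreeRefutation : ∀ {m} → CNF m → Set
TreeRefutation F = F ⊢ emptyClause

-- The number of nodes, i.e. of occurrences of clauses in the tree.
size : ∀ {m} {F : CNF m} {C} → F ⊢ C → ℕ
size (axiom _)           = 1
size (resolve _ _ _ π ρ) = suc (size π ℕ.+ size ρ)

------------------------------------------------------------------------
-- (2,k)-CSPs

Assignment : ℕ → Set
Assignment m = Vec Bool m

-- An assignment to the variables of S, listed in increasing order.
PartialAssignment : ∀ {m} → Subset m → Set
PartialAssignment S = Vec Bool ∣ S ∣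

restrict : ∀ {m} (S : Subset m) → Assignment m → PartialAssignment S
restrict []            []      = []
restrict (inside  ∷ S) (b ∷ α) = b ∷ restrict S α
restrict (outside ∷ S) (_ ∷ α) = restrict S α

-- The variable set is part of the data: the predicate need not depend on all
-- of it.
record Constraint (m k : ℕ) : Set where
  field
    vars    : Subset m
    arity≤k : ∣ vars ∣ ℕ.≤ k
    allows  : PartialAssignment vars → Bool

open Constraint public

-- Constraints form a finite family; a repeated constraint would count with
-- multiplicity towards the variable frequency.
CSP : (m k : ℕ) → Set
CSP m k = List (Constraint m k)

Satisfies : ∀ {m k} → Assignment m → CSP m k → Set
Satisfies α Ψ = All (λ c → allows c (restrict (vars c) α) ≡ true) Ψ

Unsatisfiable : ∀ {m k} → CSP m k → Set
Unsatisfiable Ψ = ∀ α → ¬ Satisfies α Ψ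

occurrences : ∀ {m k} → CSP m k → Fin m → ℕ
occurrences Ψ x = length (filter (λ c → x ∈? vars c) Ψ)

variableFrequency : ∀ {m k} → CSP m k → ℕ
variableFrequency {m} Ψ = max 0 (map (occurrences Ψ) (allFin m))

------------------------------------------------------------------------
-- CNF representation

allVecs : ∀ n → List (Vec Bool n)
allVecs zero    = [] ∷ []
allVecs (suc n) = cartesianProductWith _∷_ (false ∷ true ∷ []) (allVecs n)

-- The clause on exactly the variables in S falsified by exactly β: a variable
-- occurs positively iff β sets it to false.
falsifiedBy : ∀ {m} (S : Subset m) → PartialAssignment S → Clause m
falsifiedBy []            []      = clause [] []
falsifiedBy (outside ∷ S) β       = let C = falsifiedBy S β in
  clause (outside ∷ pos C) (outside ∷ neg C)
falsifiedBy (inside  ∷ S) (b ∷ β) = let C = falsifiedBy S β in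
  clause (not b ∷ pos C) (b ∷ neg C)

constraintCNF : ∀ {m k} → Constraint m k → CNF m
constraintCNF c =
  map (falsifiedBy (vars c)) (filter (λ β → allows c β ≟ᵇ false) (allVecs ∣ vars c ∣))

cnf : ∀ {m k} → CSP m k → CNF m
cnf = concatMap constraintCNF

{-# OPTIONS --safe #-}

-- Colour the constraints with two colours.  Once the variables that occur in
-- both colours have been queried, the two colour classes share no variable, so
-- one of them is already unsatisfiable and only its variables remain to be
-- queried.  If a and b variables occur only in the first, respectively only in
-- the second colour, the decision tree has depth m − min(a, b) + O(1).
--
-- For a uniformly random colouring, a and b have mean at least m / 2^r.  The
-- contributions of two variables to a − b are uncorrelated unless they share a
-- constraint, which happens for at most m r k pairs, so E (a − b)² ≤ m r k.
-- Hence some colouring has min(a, b) ≥ m / 2^r − o(m), and ε_r ≤ 2^{-r} because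
-- 1 − 2^{-1/r} ≤ 1/2.
module Submission where

open import Defs

-- Mean and variance must be good for the same colouring, so both enter one average. With `R = 2^r`,
-- `K = r k` and a weight `t`, the average of `(a - b)² + 2 t m` is at most that of
-- `m K + t R (a + b)`, hence some colouring satisfies this inequality itself. Dropping the square
-- gives `R (a + b) ≥ 2 m - m K / t`; dropping `2 t m` and using `a, b ≤ m` gives
-- `(a - b)² ≤ m K + 2 t R m`. For `t` of order `√m`, the first error is `o(m)` because `k = o(√m)`,
-- and the second is a deviation of order at most `m^(3/4)`. Which colour class is unsatisfiable
-- depends on the values of the shared variables, so it is settled separately below each of their
-- assignments. Averages are sums over all colourings in ℕ, with subtractions moved across and the
-- denominator `R` cleared. Rationals enter only with the final cut: `≤ᴿ` compares upper cuts, and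
-- cuts carry no axioms, so each estimate is made on the rationals that witness membership.

module Reals where

  open import Algebra.Bundles using (CommutativeRing)
  open import Data.Integer as ℤ using (+_; -[1+_])
  import Data.Integer.Properties as ℤₚ
  open import Data.Nat as ℕ using (ℕ; zero; suc; NonZero)
  import Data.Nat.Coprimality as Coprime
  import Data.Nat.Properties as ℕₚ
  open import Data.Product using (∃-syntax; _,_; _×_)
  open import Data.Rational as ℚ
    using (ℚ; mkℚ; 0ℚ; 1ℚ; ½; _/_; _+_; _*_; -_; _-_; _≤_; _<_; _⊓_; _⊔_; *≤*; ↥_; ↧_; ↧ₙ_; nonNegative)
  open import Data.Rational.Properties
  open import Data.Rational.Solver using (module +-*-Solver)
  open import Data.Sum using (inj₁; inj₂)
  open import Relation.Binary.PropositionalEquality hiding ([_])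

  -- Naturals as rationals, and integer powers

  ι : ℕ → ℚ
  ι n = + n / 1

  -- ι in lowest terms, which Agda computes with for variable n.
  ιᶜ : ℕ → ℚ
  ιᶜ n = mkℚ (+ n) 0 (Coprime.sym (Coprime.1-coprimeTo n))

  ι≡ιᶜ : ∀ n → ι n ≡ ιᶜ n
  ι≡ιᶜ n = ↥p/↧p≡p (ιᶜ n)

  ι-≤⇒ : ∀ {n q} → ι n ≤ q → + n ℤ.* ↧ q ℤ.≤ ↥ q
  ι-≤⇒ {n} {q} le = subst (+ n ℤ.* ↧ q ℤ.≤_) (ℤₚ.*-identityʳ (↥ q))
    (drop-*≤* (subst (_≤ q) (ι≡ιᶜ n) le))

  ι-mono-≤ : ∀ {m n} → m ℕ.≤ n → ι m ≤ ι n
  ι-mono-≤ {m} {n} m≤n = subst₂ _≤_ (sym (ι≡ιᶜ m)) (sym (ι≡ιᶜ n))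
    (*≤* (ℤₚ.*-monoʳ-≤-nonNeg (+ 1) (ℤ.+≤+ m≤n)))

  ι-+ : ∀ m n → ι (m ℕ.+ n) ≡ ι m + ι n
  ι-+ m n = begin
    + (m ℕ.+ n) / 1                             ≡⟨ cong (_/ 1) (cong₂ ℤ._+_ (ℤₚ.*-identityʳ (+ m)) (ℤₚ.*-identityʳ (+ n))) ⟨
    (+ m ℤ.* + 1 ℤ.+ + n ℤ.* + 1) / 1           ≡⟨⟩
    ιᶜ m + ιᶜ n               ≡⟨ cong₂ _+_ (ι≡ιᶜ m) (ι≡ιᶜ n) ⟨
    ι m + ι n                                   ∎
    where open ≡-Reasoning

  ι-* : ∀ m n → ι (m ℕ.* n) ≡ ι m * ι n
  ι-* m n = begin
    + (m ℕ.* n) / 1                             ≡⟨ cong (_/ 1) (ℤₚ.pos-* m n) ⟩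
    ιᶜ m * ιᶜ n               ≡⟨ cong₂ _*_ (ι≡ιᶜ m) (ι≡ιᶜ n) ⟨
    ι m * ι n                                   ∎
    where open ≡-Reasoning

  0≤ι : ∀ n → 0ℚ ≤ ι n
  0≤ι n = ι-mono-≤ {0} {n} ℕ.z≤n

  ι-^ : ∀ m n → ι (m ℕ.^ n) ≡ ι m ^ℚ n
  ι-^ m zero    = refl
  ι-^ m (suc n) = trans (ι-* m (m ℕ.^ n)) (cong (ι m *_) (ι-^ m n))

  *-mono-≤-nonNeg : ∀ {p q r s} → 0ℚ ≤ q → 0ℚ ≤ r → p ≤ q → r ≤ s → p * r ≤ q * s
  *-mono-≤-nonNeg {q = q} {r} 0≤q 0≤r p≤q r≤s =
    ≤-trans (*-monoʳ-≤-nonNeg r {{nonNegative 0≤r}} p≤q) (*-monoˡ-≤-nonNeg q {{nonNegative 0≤q}} r≤s)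

  ^-nonNeg : ∀ {p} n → 0ℚ ≤ p → 0ℚ ≤ p ^ℚ n
  ^-nonNeg zero    0≤p = ι-mono-≤ {0} {1} ℕ.z≤n
  ^-nonNeg {p} (suc n) 0≤p =
    nonNegative⁻¹ _ {{nonNeg*nonNeg⇒nonNeg p {{nonNegative 0≤p}} (p ^ℚ n) {{nonNegative (^-nonNeg n 0≤p)}}}}

  ^-mono-≤ : ∀ {p q} n → 0ℚ ≤ p → p ≤ q → p ^ℚ n ≤ q ^ℚ n
  ^-mono-≤ zero    0≤p p≤q = ≤-refl
  ^-mono-≤ (suc n) 0≤p p≤q =
    *-mono-≤-nonNeg (≤-trans 0≤p p≤q) (^-nonNeg n 0≤p) p≤q (^-mono-≤ n 0≤p p≤q)

  ^-cancel-< : ∀ {p q} n → 0ℚ ≤ q → p ^ℚ n < q ^ℚ n → p < q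
  ^-cancel-< n 0≤q lt = ≰⇒> λ q≤p → <-irrefl refl (<-≤-trans lt (^-mono-≤ n 0≤q q≤p))

  ^-≤1 : ∀ {p} n → 0ℚ ≤ p → p ≤ 1ℚ → p ^ℚ n ≤ 1ℚ
  ^-≤1 zero    0≤p p≤1 = ≤-refl
  ^-≤1 {p} (suc n) 0≤p p≤1 = *-mono-≤-nonNeg (ι-mono-≤ {0} {1} ℕ.z≤n) (^-nonNeg n 0≤p) p≤1 (^-≤1 n 0≤p p≤1)

  ^-≥1 : ∀ {p} n → 1ℚ ≤ p → 1ℚ ≤ p ^ℚ n
  ^-≥1 zero    1≤p = ≤-refl
  ^-≥1 {p} (suc n) 1≤p = *-mono-≤-nonNeg (≤-trans (0≤ι 1) 1≤p) (0≤ι 1) 1≤p (^-≥1 n 1≤p)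

  ^-* : ∀ p m n → p ^ℚ (m ℕ.* n) ≡ (p ^ℚ m) ^ℚ n
  ^-* p m n = sym (^-assocʳ p m n)
    where open import Algebra.Properties.Semiring.Exp (CommutativeRing.semiring +-*-commutativeRing) using (^-assocʳ)

  0≤½ : 0ℚ ≤ ½
  0≤½ = nonNegative⁻¹ ½

  ½≤1 : ½ ≤ 1ℚ
  ½≤1 = *≤* (ℤ.+≤+ (ℕ.s≤s ℕ.z≤n))

  ½^-antimono-≤ : ∀ {m n} → m ℕ.≤ n → ½ ^ℚ n ≤ ½ ^ℚ m
  ½^-antimono-≤ {n = n} ℕ.z≤n = ^-≤1 n 0≤½ ½≤1
  ½^-antimono-≤ (ℕ.s≤s m≤n)   = *-monoˡ-≤-nonNeg ½ (½^-antimono-≤ m≤n)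

  2^-mono-≤ : ∀ {m n} → m ℕ.≤ n → ι 2 ^ℚ m ≤ ι 2 ^ℚ n
  2^-mono-≤ {m} {n} m≤n = subst₂ _≤_ (ι-^ 2 m) (ι-^ 2 n) (ι-mono-≤ (ℕₚ.^-monoʳ-≤ 2 m≤n))

  ½^n*2^n≡1 : ∀ n → ½ ^ℚ n * ι (2 ℕ.^ n) ≡ 1ℚ
  ½^n*2^n≡1 zero    = refl
  ½^n*2^n≡1 (suc n) = begin
    ½ * ½ ^ℚ n * ι (2 ℕ.* 2 ℕ.^ n)      ≡⟨ cong (½ * ½ ^ℚ n *_) (ι-* 2 (2 ℕ.^ n)) ⟩
    ½ * ½ ^ℚ n * (ι 2 * ι (2 ℕ.^ n))    ≡⟨ eq ½ (½ ^ℚ n) (ι 2) (ι (2 ℕ.^ n)) ⟩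
    ½ * ι 2 * (½ ^ℚ n * ι (2 ℕ.^ n))    ≡⟨ cong (½ * ι 2 *_) (½^n*2^n≡1 n) ⟩
    1ℚ                                  ∎
    where
    open ≡-Reasoning
    eq : ∀ a b c d → a * b * (c * d) ≡ a * c * (b * d)
    eq = solve 4 (λ a b c d → a :* b :* (c :* d) := a :* c :* (b :* d)) refl
      where open +-*-Solver

  -- `2^ℚ q` is the `↧ₙ q`-th root of `2^ℤ (↥ q)`, so bounds on `2^q` are stated after raising both
  -- sides to the denominator: here `½ ≤ 2^q`, in the next two lemmas `2^q ≤ 1` and `2^n ≤ 2^q`.
  -1≤⇒½^↧≤2^ℤ↥ : ∀ q → - 1ℚ ≤ q → ½ ^ℚ ↧ₙ q ≤ 2^ℤ (↥ q)
  -1≤⇒½^↧≤2^ℤ↥ (mkℚ (+ n) d _) -1≤q = ≤-trans (^-≤1 (suc d) 0≤½ ½≤1) (^-≥1 n (ι-mono-≤ {1} {2} (ℕ.s≤s ℕ.z≤n)))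
  -1≤⇒½^↧≤2^ℤ↥ (mkℚ -[1+ n ] d _) (*≤* le) with le
  ... | le′ = ½^-antimono-≤ (ℕ.s≤s (n≤d (subst₂ ℤ._≤_ (ℤₚ.-1*i≡-i (+ suc d)) (ℤₚ.*-identityʳ -[1+ n ]) le′)))
    where
    n≤d : -[1+ d ] ℤ.≤ -[1+ n ] → n ℕ.≤ d
    n≤d (ℤ.-≤- le) = le

  ≤0⇒2^ℤ↥≤1 : ∀ q → q ≤ 0ℚ → 2^ℤ (↥ q) ≤ 1ℚ
  ≤0⇒2^ℤ↥≤1 (mkℚ (+ zero)  d _) _ = ≤-refl
  ≤0⇒2^ℤ↥≤1 (mkℚ (+ suc n) d _) (*≤* (ℤ.+≤+ ()))
  ≤0⇒2^ℤ↥≤1 (mkℚ -[1+ n ]  d _) _ = ^-≤1 (suc n) 0≤½ ½≤1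

  2^n^↧≤2^ℤ↥ : ∀ n q → ι n ≤ q → (ι (2 ℕ.^ n)) ^ℚ ↧ₙ q ≤ 2^ℤ (↥ q)
  2^n^↧≤2^ℤ↥ n (mkℚ i d c) n≤q = go i (ι-≤⇒ {n} {mkℚ i d c} n≤q)
    where
    go : ∀ i → + n ℤ.* + suc d ℤ.≤ i → (ι (2 ℕ.^ n)) ^ℚ suc d ≤ 2^ℤ i
    go i le with subst (ℤ._≤ i) (sym (ℤₚ.pos-* n (suc d))) le
    ... | ℤ.+≤+ {n = j} nd≤j = subst (_≤ ι 2 ^ℚ j)
      (trans (^-* (ι 2) n (suc d)) (cong (_^ℚ suc d) (sym (ι-^ 2 n)))) (2^-mono-≤ nd≤j)

  0≤1/r : ∀ r .{{_ : NonZero r}} → 0ℚ ≤ + 1 / r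
  0≤1/r r = nonNegative⁻¹ _ {{normalize-nonNeg 1 r}}

  1/r≤1 : ∀ r .{{_ : NonZero r}} → + 1 / r ≤ 1ℚ
  1/r≤1 r@(suc r-1) = subst (_≤ 1ℚ) (sym (normalize-coprime {1} {r-1} (Coprime.1-coprimeTo r)))
    (*≤* (ℤ.+≤+ (ℕ.s≤s ℕ.z≤n)))

  neg-involutive : ∀ p → - - p ≡ p
  neg-involutive = solve 1 (λ p → :- :- p := p) refl
    where open +-*-Solver

  p<-q⇒q<-p : ∀ {p q} → p < - q → q < - p
  p<-q⇒q<-p {p} {q} lt = subst (_< - p) (neg-involutive q) (neg-antimono-< lt)

  -p<q⇒-q<p : ∀ {p q} → - p < q → - q < p
  -p<q⇒-q<p {p} {q} lt = subst (- q <_) (neg-involutive p) (neg-antimono-< lt)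

  -- The cuts of ε_r and of the exponent

  module _ (r : ℕ) .{{_ : NonZero r}} where

    base : ℝ
    base = fromℕ 1 -ᴿ 2^ (-ᴿ fromℚ (+ 1 / r))

    -- A rational above `2^(-1/r)` is witnessed by some `q > -1/r ≥ -1`, so it exceeds `½`.
    L-base≤½ : ∀ {a} → L base a → a ≤ ½
    L-base≤½ (u , v , u<1 , (q , -q<1/r , 0<-v , lt) , refl) = begin
      u + v              ≤⟨ +-mono-≤ (<⇒≤ u<1) (<⇒≤ v<-½) ⟩
      1ℚ + - ½           ≡⟨⟩
      ½                  ∎
      where
      open ≤-Reasoning
      -1≤q : - 1ℚ ≤ q
      -1≤q = ≤-trans (neg-antimono-≤ (1/r≤1 r)) (<⇒≤ (-p<q⇒-q<p -q<1/r))
      v<-½ : v < - ½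
      v<-½ = p<-q⇒q<-p {½} (^-cancel-< {½} (↧ₙ q) (<⇒≤ 0<-v) (≤-<-trans (-1≤⇒½^↧≤2^ℤ↥ q -1≤q) lt))

    -- Comes from `2^(-1/r) ≤ 1`. Interval products need it: the sign of the upper endpoints
    -- controls the products with negative lower ones.
    U-base≥0 : ∀ {b} → U base b → 0ℚ ≤ b
    U-base≥0 (u , v , 1<u , (q , 1/r<-q , lt) , refl) = +-mono-≤ (<⇒≤ 1<u) (-1≤v lt)
      where
      q≤0 : q ≤ 0ℚ
      q≤0 = <⇒≤ (<-≤-trans (p<-q⇒q<-p 1/r<-q) (neg-antimono-≤ (0≤1/r r)))
      -1≤v : L (2^ℚ q) (- v) → - 1ℚ ≤ v
      -1≤v lt = <⇒≤ (-p<q⇒-q<p (-v<1 lt))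
        where
        -v<1 : L (2^ℚ q) (- v) → - v < 1ℚ
        -v<1 (inj₁ -v<0) = <-≤-trans -v<0 (0≤ι 1)
        -v<1 (inj₂ lt)   = ^-cancel-< (↧ₙ q) (0≤ι 1)
          (<-≤-trans lt (≤-trans (≤0⇒2^ℤ↥≤1 q q≤0) (^-≥1 (↧ₙ q) ≤-refl)))

    U-base^≥0 : ∀ n {d} → U (base ^ᴿ n) d → 0ℚ ≤ d
    U-base^≥0 zero    1<d = ≤-trans (0≤ι 1) (<⇒≤ 1<d)
    U-base^≥0 (suc n) {q} (a , b , c , d , _ , b> , _ , d> , max<q) = begin
      0ℚ                                                ≡⟨ *-zeroˡ 0ℚ ⟨
      0ℚ * 0ℚ                                           ≤⟨ *-mono-≤-nonNeg 0≤b ≤-refl 0≤b (U-base^≥0 n d>) ⟩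
      b * d                                             ≤⟨ p≤q⊔p (b * c) (b * d) ⟩
      (b * c) ⊔ (b * d)                                 ≤⟨ p≤q⊔p ((a * c) ⊔ (a * d)) _ ⟩
      ((a * c) ⊔ (a * d)) ⊔ ((b * c) ⊔ (b * d))         <⟨ max<q ⟩
      q                                                 ∎
      where
      open ≤-Reasoning
      0≤b = U-base≥0 b>

    -- Lower endpoints may be negative, and a product of two negative ones gives no useful bound. If
    -- one of them is nonpositive, its product with the nonnegative upper endpoint of the other
    -- factor already forces `q` below 0; otherwise `a * c` does the work.
    L-base^≤½^ : ∀ n {c} → L (base ^ᴿ n) c → c ≤ ½ ^ℚ n
    L-base^≤½^ zero    c<1 = <⇒≤ c<1
    L-base^≤½^ (suc n) {q} (a , b , c , d , a< , b> , c< , d> , q<min) with ≤-total 0ℚ a | ≤-total 0ℚ c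
    ... | inj₁ 0≤a | inj₁ 0≤c = ≤-trans (<⇒≤ (<-≤-trans q<min (≤-trans (p⊓q≤p _ _) (p⊓q≤p (a * c) _))))
      (*-mono-≤-nonNeg 0≤½ 0≤c (L-base≤½ a<) (L-base^≤½^ n c<))
    ... | inj₁ _   | inj₂ c≤0 = ≤-trans (<⇒≤ (<-≤-trans q<min (≤-trans (p⊓q≤q ((a * c) ⊓ (a * d)) _) (p⊓q≤p (b * c) _))))
      (≤-trans (≤-trans (*-monoˡ-≤-nonNeg b {{nonNegative (U-base≥0 b>)}} c≤0) (≤-reflexive (*-zeroʳ b)))
               (^-nonNeg (suc n) 0≤½))
    ... | inj₂ a≤0 | _        = ≤-trans (<⇒≤ (<-≤-trans q<min (≤-trans (p⊓q≤p _ _) (p⊓q≤q (a * c) _))))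
      (≤-trans (≤-trans (*-monoʳ-≤-nonNeg d {{nonNegative (U-base^≥0 n d>)}} a≤0) (≤-reflexive (*-zeroˡ d)))
               (^-nonNeg (suc n) 0≤½))

    U[1-ε]≥1-½^r : ∀ {b} → U (fromℕ 1 -ᴿ ε r) b → 1ℚ - ½ ^ℚ r ≤ b
    U[1-ε]≥1-½^r (u , v , 1<u , -v<ε , refl) = +-mono-≤ (<⇒≤ 1<u)
      (subst (- (½ ^ℚ r) ≤_) (neg-involutive v) (neg-antimono-≤ (L-base^≤½^ r -v<ε)))

    -- The hypothesis is `s ≤ (1 - 2^(-r)) m + e` multiplied by `2^r`; the rest is
    -- `1 - 2^(-r) ≤ 1 - ε_r`.
    exponent-bound : ∀ {m e s} → 2 ℕ.^ r ℕ.* s ℕ.+ m ℕ.≤ 2 ℕ.^ r ℕ.* (m ℕ.+ e) →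
                     ∀ {q} → U ((fromℕ 1 -ᴿ ε r) *ᴿ fromℕ m +ᴿ fromℕ e) q → ι s ≤ q
    exponent-bound {m} {e} {s} le (x , y , (a , b , c , d , _ , b> , _ , m<d , max<x) , e<y , refl) = begin
      ι s                                      ≡⟨ eq₁ h (ι s) (ι m) ⟩
      (ι s + h * ι m) - h * ι m                ≤⟨ +-monoˡ-≤ (- (h * ι m)) scaled ⟩
      (ι m + ι e) - h * ι m                    ≡⟨ eq₂ h (ι m) (ι e) ⟩
      (1ℚ - h) * ι m + ι e                     ≤⟨ +-mono-≤ product (<⇒≤ e<y) ⟩
      x + y                                    ∎
      where
      open ≤-Reasoning
      h = ½ ^ℚ r
      0≤1-h : 0ℚ ≤ 1ℚ - h
      0≤1-h = subst (_≤ 1ℚ - h) (+-inverseʳ h) (+-monoˡ-≤ (- h) (^-≤1 r 0≤½ ½≤1))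
      product : (1ℚ - h) * ι m ≤ x
      product = begin
        (1ℚ - h) * ι m                                  ≤⟨ *-mono-≤-nonNeg 0≤b (0≤ι m) (U[1-ε]≥1-½^r b>) (<⇒≤ m<d) ⟩
        b * d                                           ≤⟨ p≤q⊔p (b * c) (b * d) ⟩
        (b * c) ⊔ (b * d)                               ≤⟨ p≤q⊔p ((a * c) ⊔ (a * d)) _ ⟩
        ((a * c) ⊔ (a * d)) ⊔ ((b * c) ⊔ (b * d))       <⟨ max<x ⟩
        x                                               ∎
        where
        0≤b : 0ℚ ≤ b
        0≤b = ≤-trans 0≤1-h (U[1-ε]≥1-½^r b>)
      unscale : ∀ p → h * (ι (2 ℕ.^ r) * p) ≡ p
      unscale p = trans (sym (*-assoc h (ι (2 ℕ.^ r)) p))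
                        (trans (cong (_* p) (½^n*2^n≡1 r)) (*-identityˡ p))
      scaled : ι s + h * ι m ≤ ι m + ι e
      scaled = begin
        ι s + h * ι m                                   ≡⟨ cong (_+ h * ι m) (unscale (ι s)) ⟨
        h * (ι (2 ℕ.^ r) * ι s) + h * ι m               ≡⟨ *-distribˡ-+ h _ (ι m) ⟨
        h * (ι (2 ℕ.^ r) * ι s + ι m)                   ≡⟨ cong (λ p → h * (p + ι m)) (ι-* (2 ℕ.^ r) s) ⟨
        h * (ι (2 ℕ.^ r ℕ.* s) + ι m)                   ≡⟨ cong (h *_) (ι-+ (2 ℕ.^ r ℕ.* s) m) ⟨
        h * ι (2 ℕ.^ r ℕ.* s ℕ.+ m)                     ≤⟨ *-monoˡ-≤-nonNeg h {{nonNegative (^-nonNeg r 0≤½)}} (ι-mono-≤ le) ⟩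
        h * ι (2 ℕ.^ r ℕ.* (m ℕ.+ e))                   ≡⟨ cong (h *_) (ι-* (2 ℕ.^ r) (m ℕ.+ e)) ⟩
        h * (ι (2 ℕ.^ r) * ι (m ℕ.+ e))                 ≡⟨ unscale (ι (m ℕ.+ e)) ⟩
        ι (m ℕ.+ e)                                     ≡⟨ ι-+ m e ⟩
        ι m + ι e                                       ∎
      open +-*-Solver
      eq₁ : ∀ h s m → s ≡ (s + h * m) - h * m
      eq₁ = solve 3 (λ h s m → s := (s :+ h :* m) :- h :* m) refl
      eq₂ : ∀ h m e → (m + e) - h * m ≡ (1ℚ - h) * m + e
      eq₂ = solve 3 (λ h m e → (m :+ e) :- h :* m := (con 1ℚ :- h) :* m :+ e) refl

    size-bound : ∀ {m e s t} → 2 ℕ.^ r ℕ.* s ℕ.+ m ℕ.≤ 2 ℕ.^ r ℕ.* (m ℕ.+ e) → t ℕ.< 2 ℕ.^ s →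
                 fromℕ t ≤ᴿ 2^ ((fromℕ 1 -ᴿ ε r) *ᴿ fromℕ m +ᴿ fromℕ e)
    size-bound {s = s} le t<2^s p (q , q> , 0<p , lt) = ≤-<-trans (ι-mono-≤ (ℕₚ.<⇒≤ t<2^s))
      (^-cancel-< (↧ₙ q) (<⇒≤ 0<p) (≤-<-trans (2^n^↧≤2^ℤ↥ s q (exponent-bound le q>)) lt))

  ∈o-fromℕ : ∀ {f} → (∀ c → ∃[ M ] (∀ m → M ℕ.≤ m → c ℕ.* f m ℕ.≤ m)) → f ∈o fromℕ
  ∈o-fromℕ f-sub c = let M , le = f-sub c in M , λ m M≤m q m<q → ≤-<-trans (ι-mono-≤ (le m M≤m)) m<q

  -- The test point is `c * f m` itself: were its square above `m`, it would lie in the upper cut of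
  -- `√ m` and hence in its own upper cut.
  ∈o-√⇒square : ∀ {f} → f ∈o √_ → ∀ c → ∃[ M ] (∀ m → M ℕ.≤ m → c ℕ.* f m ℕ.* (c ℕ.* f m) ℕ.≤ m)
  ∈o-√⇒square {f} f-small c = let M , le = f-small c in M , λ m M≤m → ℕₚ.≮⇒≥ λ m<x² →
    <-irrefl refl (le m M≤m (ι (c ℕ.* f m)) (0<x (c ℕ.* f m) m<x² , m<ιx² (c ℕ.* f m) m<x²))
    where
    ι-mono-< : ∀ {m n} → m ℕ.< n → ι m < ι n
    ι-mono-< {m} {n} m<n = ≰⇒> λ ιn≤ιm → ℕₚ.<⇒≱ m<n (ι-cancel-≤ ιn≤ιm)
      where
      ι-cancel-≤ : ∀ {m n} → ι m ≤ ι n → m ℕ.≤ n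
      ι-cancel-≤ {m} {n} le with subst₂ ℤ._≤_ (ℤₚ.*-identityʳ (+ m)) (ℤₚ.*-identityʳ (+ n))
                                   (drop-*≤* (subst₂ _≤_ (ι≡ιᶜ m) (ι≡ιᶜ n) le))
      ... | ℤ.+≤+ m≤n = m≤n
    0<x : ∀ x {m} → m ℕ.< x ℕ.* x → 0ℚ < ι x
    0<x (suc x) _ = ι-mono-< {0} {suc x} (ℕ.s≤s ℕ.z≤n)
    m<ιx² : ∀ x {m} → m ℕ.< x ℕ.* x → ι m < ι x ^ℚ 2
    m<ιx² x m<x² = <-≤-trans (ι-mono-< m<x²)
      (≤-reflexive (trans (ι-* x x) (cong (ι x *_) (sym (*-identityʳ (ι x))))))

module Combinatorics where

  open import Data.Bool using (Bool; true; false; not; _∧_; if_then_else_) renaming (_≟_ to _≟ᵇ_)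
  open import Data.Bool.Properties using (not-involutive)
  open import Data.Empty using (⊥; ⊥-elim)
  open import Data.Fin using (Fin; zero; suc)
  open import Data.Fin.Properties using (any?) renaming (_≟_ to _≟ᶠ_)
  open import Data.Fin.Subset using (Subset; ∣_∣; _∩_; ∁; _-_; _─_) renaming (_∈_ to _∈ˢ_; _∉_ to _∉ˢ_)
  open import Data.Fin.Subset.Properties using (_∈?_; x∈p∪q⁻; p─q⊆p; x∈⁅x⁆; Empty-unique)
  open import Data.List using (List; []; _∷_; length; filter; allFin; map) renaming (lookup to lookupᴸ; tabulate to tabulateᴸ)
  open import Data.List.Extrema.Nat using (xs≤max)
  import Data.List.Membership.DecPropositional as DecMembership
  open import Data.List.Membership.Propositional using (_∈_; _∉_)
  open import Data.List.Membership.Propositional.Properties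
    using (∈-filter⁺; ∈-filter⁻; ∈-allFin; ∈-map⁺; ∈-concatMap⁺; ∈-cartesianProductWith⁺; ∈-lookup)
  open import Data.List.Relation.Unary.All using () renaming (lookup to All-lookup; tabulate to All-tabulate)
  open import Data.List.Relation.Unary.Any as Any using (here; there; index)
  open import Data.List.Relation.Unary.Any.Properties using (lookup-index)
  open import Data.Nat
  open import Data.Nat.Properties
  open import Data.Nat.Tactic.RingSolver using (solve-∀)
  open import Algebra.Properties.Semiring.Sum +-*-semiring
    using (sum; sum-cong-≗; ∑-distrib-+; *-distribˡ-sum; *-distribʳ-sum)
  open import Data.Product using (∃-syntax; Σ-syntax; _,_; _×_; proj₁; proj₂)
  open import Data.Sum using (_⊎_; inj₁; inj₂; [_,_]′)
  open import Data.Vec using (Vec; []; _∷_; lookup; _[_]≔_; tabulate; replicate; here; there)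
  open import Data.Vec.Properties
    using (lookup∘update; lookup∘update′; lookup∘tabulate; []=⇒lookup; lookup⇒[]=; lookup-map)
  open import Function using (_∘_; id)
  open import Relation.Binary.PropositionalEquality
  open import Relation.Nullary using (yes; no; contradiction; does)
  open import Relation.Nullary.Decidable using (_×-dec_)

  -- Finite sums and averages over colourings

  sum-mono-≤ : ∀ {n} {f g : Fin n → ℕ} → (∀ i → f i ≤ g i) → sum f ≤ sum g
  sum-mono-≤ {zero}  f≤g = z≤n
  sum-mono-≤ {suc n} f≤g = +-mono-≤ (f≤g zero) (sum-mono-≤ (f≤g ∘ suc))

  sum-const : ∀ n c → sum {n} (λ _ → c) ≡ n * c
  sum-const zero    c = refl
  sum-const (suc n) c = cong (c +_) (sum-const n c)

  sum-*-sum : ∀ {m n} (f : Fin m → ℕ) (g : Fin n → ℕ) →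
              sum f * sum g ≡ sum (λ x → sum (λ y → f x * g y))
  sum-*-sum f g = trans (*-distribʳ-sum (sum g) f) (sum-cong-≗ (λ x → *-distribˡ-sum (f x) g))

  sum-sum-+ : ∀ {m n} (f g : Fin m → Fin n → ℕ) →
              sum (λ x → sum (λ y → f x y + g x y)) ≡
              sum (λ x → sum (f x)) + sum (λ x → sum (g x))
  sum-sum-+ f g = trans (sum-cong-≗ (λ x → ∑-distrib-+ (f x) (g x)))
                        (∑-distrib-+ (λ x → sum (f x)) (λ x → sum (g x)))

  -- A colouring is the `Subset` of the constraints of the first colour, so `∑ˢ n` is `2 ^ n` times
  -- the expectation over a uniform colouring.
  ∑ˢ : ∀ n → (Subset n → ℕ) → ℕ
  ∑ˢ zero    f = f []
  ∑ˢ (suc n) f = ∑ˢ n (f ∘ (false ∷_)) + ∑ˢ n (f ∘ (true ∷_))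

  ∑ˢ-mono-≤ : ∀ n {f g} → (∀ χ → f χ ≤ g χ) → ∑ˢ n f ≤ ∑ˢ n g
  ∑ˢ-mono-≤ zero    f≤g = f≤g []
  ∑ˢ-mono-≤ (suc n) f≤g =
    +-mono-≤ (∑ˢ-mono-≤ n (f≤g ∘ (false ∷_))) (∑ˢ-mono-≤ n (f≤g ∘ (true ∷_)))

  ∑ˢ-cong : ∀ n {f g} → (∀ χ → f χ ≡ g χ) → ∑ˢ n f ≡ ∑ˢ n g
  ∑ˢ-cong zero    f≗g = f≗g []
  ∑ˢ-cong (suc n) f≗g =
    cong₂ _+_ (∑ˢ-cong n (f≗g ∘ (false ∷_))) (∑ˢ-cong n (f≗g ∘ (true ∷_)))

  ∑ˢ-+ : ∀ n f g → ∑ˢ n (λ χ → f χ + g χ) ≡ ∑ˢ n f + ∑ˢ n g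
  ∑ˢ-+ zero    f g = refl
  ∑ˢ-+ (suc n) f g
    rewrite ∑ˢ-+ n (f ∘ (false ∷_)) (g ∘ (false ∷_)) | ∑ˢ-+ n (f ∘ (true ∷_)) (g ∘ (true ∷_)) =
    +-interchange (∑ˢ n (f ∘ (false ∷_))) _ _ _
    where
    +-interchange : ∀ a b c d → (a + b) + (c + d) ≡ (a + c) + (b + d)
    +-interchange = solve-∀

  ∑ˢ-const : ∀ n c → ∑ˢ n (λ _ → c) ≡ 2 ^ n * c
  ∑ˢ-const zero    c = sym (+-identityʳ c)
  ∑ˢ-const (suc n) c rewrite ∑ˢ-const n c = double (2 ^ n) c
    where
    double : ∀ p c → p * c + p * c ≡ (p + (p + 0)) * c
    double = solve-∀

  ∑ˢ-* : ∀ n c f → ∑ˢ n (λ χ → c * f χ) ≡ c * ∑ˢ n f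
  ∑ˢ-* zero    c f = refl
  ∑ˢ-* (suc n) c f
    rewrite ∑ˢ-* n c (f ∘ (false ∷_)) | ∑ˢ-* n c (f ∘ (true ∷_)) = sym (*-distribˡ-+ c _ _)

  ∑ˢ-sum : ∀ n {m} (f : Fin m → Subset n → ℕ) →
           ∑ˢ n (λ χ → sum (λ x → f x χ)) ≡ sum (λ x → ∑ˢ n (f x))
  ∑ˢ-sum n {zero}  f = trans (∑ˢ-const n 0) (*-zeroʳ (2 ^ n))
  ∑ˢ-sum n {suc m} f = trans (∑ˢ-+ n (f zero) _) (cong (∑ˢ n (f zero) +_) (∑ˢ-sum n (f ∘ suc)))

  -- Averaging, one coordinate at a time: when the `false` half satisfies the reverse inequality,
  -- cancelling it leaves the claim for the `true` half.
  ∑ˢ-≤⇒∃≤ : ∀ n {f g} → ∑ˢ n f ≤ ∑ˢ n g → ∃[ χ ] f χ ≤ g χ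
  ∑ˢ-≤⇒∃≤ zero    f≤g = [] , f≤g
  ∑ˢ-≤⇒∃≤ (suc n) {f} {g} f≤g with ≤-total (∑ˢ n (f ∘ (false ∷_))) (∑ˢ n (g ∘ (false ∷_)))
  ... | inj₁ l≤ = let χ , p = ∑ˢ-≤⇒∃≤ n l≤ in false ∷ χ , p
  ... | inj₂ l≥ = let χ , p = ∑ˢ-≤⇒∃≤ n (+-cancel-≥ l≥ f≤g) in true ∷ χ , p
    where
    +-cancel-≥ : ∀ {a b c d} → c ≤ a → a + b ≤ c + d → b ≤ d
    +-cancel-≥ {a} {b} {c} {d} c≤a le = +-cancelˡ-≤ c b d (≤-trans (+-monoˡ-≤ b c≤a) le)

  -- Moments of the monochromatic counts

  within : ∀ {n} → Subset n → Subset n → Bool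
  within []          []          = true
  within (false ∷ v) (_     ∷ χ) = within v χ
  within (true  ∷ v) (true  ∷ χ) = within v χ
  within (true  ∷ v) (false ∷ χ) = false

  bit : Bool → ℕ
  bit true  = 1
  bit false = 0

  bit≤1 : ∀ b → bit b ≤ 1
  bit≤1 true  = s≤s z≤n
  bit≤1 false = z≤n

  sum-bit≤ : ∀ {m} (p : Fin m → Bool) → sum (bit ∘ p) ≤ m
  sum-bit≤ {m} p = ≤-trans (sum-mono-≤ (bit≤1 ∘ p))
                           (≤-reflexive (trans (sum-const m 1) (*-identityʳ m)))

  -- For `v` the set of constraints on a variable, these indicate that the variable avoids the other
  -- colour; a variable in no constraint counts for both.
  inᴬ inᴮ : ∀ {n} → Subset n → Subset n → ℕ
  inᴬ v χ = bit (within v χ)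
  inᴮ v χ = bit (within v (∁ χ))

  -- All of `v` has the first colour with probability `2^(-∣v∣)`: a coordinate outside `v` doubles
  -- the number of good colourings, one inside `v` keeps it and doubles `2 ^ ∣ v ∣` instead.
  2^n≤2^∣v∣*∑ˢinᴬ : ∀ {n} (v : Subset n) → 2 ^ n ≤ 2 ^ ∣ v ∣ * ∑ˢ n (inᴬ v)
  2^n≤2^∣v∣*∑ˢinᴬ []          = ≤-refl
  2^n≤2^∣v∣*∑ˢinᴬ {suc n} (false ∷ v) = begin
    2 * 2 ^ n                                ≤⟨ *-monoʳ-≤ 2 (2^n≤2^∣v∣*∑ˢinᴬ v) ⟩
    2 * (2 ^ ∣ v ∣ * ∑ˢ n (inᴬ v))            ≡⟨ eq (2 ^ ∣ v ∣) (∑ˢ n (inᴬ v)) ⟩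
    2 ^ ∣ v ∣ * (∑ˢ n (inᴬ v) + ∑ˢ n (inᴬ v)) ∎
    where
    open ≤-Reasoning
    eq : ∀ p s → 2 * (p * s) ≡ p * (s + s)
    eq = solve-∀
  2^n≤2^∣v∣*∑ˢinᴬ {suc n} (true ∷ v) = begin
    2 * 2 ^ n                                ≤⟨ *-monoʳ-≤ 2 (2^n≤2^∣v∣*∑ˢinᴬ v) ⟩
    2 * (2 ^ ∣ v ∣ * ∑ˢ n (inᴬ v))            ≡⟨ *-assoc 2 (2 ^ ∣ v ∣) _ ⟨
    2 * 2 ^ ∣ v ∣ * ∑ˢ n (inᴬ v)              ≤⟨ *-monoʳ-≤ (2 * 2 ^ ∣ v ∣) (m≤n+m _ (∑ˢ n (λ _ → 0))) ⟩
    2 * 2 ^ ∣ v ∣ * (∑ˢ n (λ _ → 0) + ∑ˢ n (inᴬ v)) ∎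
    where open ≤-Reasoning

  2^n≤2^∣v∣*∑ˢinᴮ : ∀ {n} (v : Subset n) → 2 ^ n ≤ 2 ^ ∣ v ∣ * ∑ˢ n (inᴮ v)
  2^n≤2^∣v∣*∑ˢinᴮ []          = ≤-refl
  2^n≤2^∣v∣*∑ˢinᴮ {suc n} (false ∷ v) = begin
    2 * 2 ^ n                                ≤⟨ *-monoʳ-≤ 2 (2^n≤2^∣v∣*∑ˢinᴮ v) ⟩
    2 * (2 ^ ∣ v ∣ * ∑ˢ n (inᴮ v))            ≡⟨ eq (2 ^ ∣ v ∣) (∑ˢ n (inᴮ v)) ⟩
    2 ^ ∣ v ∣ * (∑ˢ n (inᴮ v) + ∑ˢ n (inᴮ v)) ∎
    where
    open ≤-Reasoning
    eq : ∀ p s → 2 * (p * s) ≡ p * (s + s)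
    eq = solve-∀
  2^n≤2^∣v∣*∑ˢinᴮ {suc n} (true ∷ v) = begin
    2 * 2 ^ n                                ≤⟨ *-monoʳ-≤ 2 (2^n≤2^∣v∣*∑ˢinᴮ v) ⟩
    2 * (2 ^ ∣ v ∣ * ∑ˢ n (inᴮ v))            ≡⟨ *-assoc 2 (2 ^ ∣ v ∣) _ ⟨
    2 * 2 ^ ∣ v ∣ * ∑ˢ n (inᴮ v)              ≤⟨ *-monoʳ-≤ (2 * 2 ^ ∣ v ∣) (m≤m+n _ (∑ˢ n (λ _ → 0))) ⟩
    2 * 2 ^ ∣ v ∣ * (∑ˢ n (inᴮ v) + ∑ˢ n (λ _ → 0)) ∎
    where open ≤-Reasoning

  -- The positive and the negative terms of `(inᴬ v - inᴮ v) (inᴬ w - inᴮ w)`.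
  same cross : ∀ {n} → Subset n → Subset n → Subset n → ℕ
  same  v w χ = inᴬ v χ * inᴬ w χ + inᴮ v χ * inᴮ w χ
  cross v w χ = inᴬ v χ * inᴮ w χ + inᴮ v χ * inᴬ w χ

  -- E (inᴬ v − inᴮ v) (inᴬ w − inᴮ w) = 0 when v and w are disjoint, with the
  -- negative terms moved to the right.
  ∑ˢ-same≤cross : ∀ {n} (v w : Subset n) →
                  ∑ˢ n (same v w) ≤ ∑ˢ n (cross v w) + 2 ^ n * ∣ v ∩ w ∣
  ∑ˢ-same≤cross [] [] = s≤s (s≤s z≤n)
  ∑ˢ-same≤cross {suc n} (false ∷ v) (false ∷ w) = begin
    s + s                       ≤⟨ +-mono-≤ (∑ˢ-same≤cross v w) (∑ˢ-same≤cross v w) ⟩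
    (c + p * k) + (c + p * k)   ≡⟨ eq c p k ⟩
    (c + c) + 2 * p * k         ∎
    where
    open ≤-Reasoning
    s = ∑ˢ n (same v w)
    c = ∑ˢ n (cross v w)
    p = 2 ^ n
    k = ∣ v ∩ w ∣
    eq : ∀ c p k → (c + p * k) + (c + p * k) ≡ (c + c) + 2 * p * k
    eq = solve-∀
  -- A coordinate in just one of the sets keeps the `inᴮ` term of that set in the `false` half and
  -- the `inᴬ` term in the `true` half, so the two halves add up to the sums without it.
  ∑ˢ-same≤cross {suc n} (false ∷ v) (true ∷ w) = begin
    ∑ˢ n (λ χ → inᴬ v χ * 0 + inᴮ v χ * inᴮ w χ) + ∑ˢ n (λ χ → inᴬ v χ * inᴬ w χ + inᴮ v χ * 0)
      ≡⟨ ∑ˢ-+ n _ _ ⟨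
    ∑ˢ n (λ χ → (inᴬ v χ * 0 + inᴮ v χ * inᴮ w χ) + (inᴬ v χ * inᴬ w χ + inᴮ v χ * 0))
      ≡⟨ ∑ˢ-cong n (λ χ → eq₁ (inᴬ v χ) (inᴮ v χ) (inᴬ w χ) (inᴮ w χ)) ⟩
    ∑ˢ n (same v w)
      ≤⟨ ∑ˢ-same≤cross v w ⟩
    ∑ˢ n (cross v w) + p * k
      ≤⟨ +-monoʳ-≤ _ (*-monoˡ-≤ k (m≤m+n p (p + 0))) ⟩
    ∑ˢ n (cross v w) + 2 * p * k
      ≡⟨ cong (_+ 2 * p * k) (∑ˢ-cong n (λ χ → eq₂ (inᴬ v χ) (inᴮ v χ) (inᴬ w χ) (inᴮ w χ))) ⟩
    ∑ˢ n (λ χ → (inᴬ v χ * inᴮ w χ + inᴮ v χ * 0) + (inᴬ v χ * 0 + inᴮ v χ * inᴬ w χ)) + 2 * p * k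
      ≡⟨ cong (_+ 2 * p * k) (∑ˢ-+ n _ _) ⟩
    ∑ˢ n (λ χ → inᴬ v χ * inᴮ w χ + inᴮ v χ * 0) + ∑ˢ n (λ χ → inᴬ v χ * 0 + inᴮ v χ * inᴬ w χ) + 2 * p * k ∎
    where
    open ≤-Reasoning
    p = 2 ^ n
    k = ∣ v ∩ w ∣
    eq₁ : ∀ a b c d → (a * 0 + b * d) + (a * c + b * 0) ≡ a * c + b * d
    eq₁ = solve-∀
    eq₂ : ∀ a b c d → a * d + b * c ≡ (a * d + b * 0) + (a * 0 + b * c)
    eq₂ = solve-∀
  ∑ˢ-same≤cross {suc n} (true ∷ v) (false ∷ w) = begin
    ∑ˢ n (λ χ → inᴮ v χ * inᴮ w χ) + ∑ˢ n (λ χ → inᴬ v χ * inᴬ w χ + 0)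
      ≡⟨ ∑ˢ-+ n _ _ ⟨
    ∑ˢ n (λ χ → inᴮ v χ * inᴮ w χ + (inᴬ v χ * inᴬ w χ + 0))
      ≡⟨ ∑ˢ-cong n (λ χ → eq₁ (inᴬ v χ) (inᴮ v χ) (inᴬ w χ) (inᴮ w χ)) ⟩
    ∑ˢ n (same v w)
      ≤⟨ ∑ˢ-same≤cross v w ⟩
    ∑ˢ n (cross v w) + p * k
      ≤⟨ +-monoʳ-≤ _ (*-monoˡ-≤ k (m≤m+n p (p + 0))) ⟩
    ∑ˢ n (cross v w) + 2 * p * k
      ≡⟨ cong (_+ 2 * p * k) (∑ˢ-cong n (λ χ → eq₂ (inᴬ v χ) (inᴮ v χ) (inᴬ w χ) (inᴮ w χ))) ⟩
    ∑ˢ n (λ χ → inᴮ v χ * inᴬ w χ + (inᴬ v χ * inᴮ w χ + 0)) + 2 * p * k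
      ≡⟨ cong (_+ 2 * p * k) (∑ˢ-+ n _ _) ⟩
    ∑ˢ n (λ χ → inᴮ v χ * inᴬ w χ) + ∑ˢ n (λ χ → inᴬ v χ * inᴮ w χ + 0) + 2 * p * k ∎
    where
    open ≤-Reasoning
    p = 2 ^ n
    k = ∣ v ∩ w ∣
    eq₁ : ∀ a b c d → b * d + (a * c + 0) ≡ a * c + b * d
    eq₁ = solve-∀
    eq₂ : ∀ a b c d → a * d + b * c ≡ b * c + (a * d + 0)
    eq₂ = solve-∀
  -- A common coordinate needs no induction: each half of `same` is at most `2 ^ n`, and the first
  -- unit of the overlap pays for both.
  ∑ˢ-same≤cross {suc n} (true ∷ v) (true ∷ w) = begin
    ∑ˢ n (λ χ → inᴮ v χ * inᴮ w χ) + ∑ˢ n (λ χ → inᴬ v χ * inᴬ w χ + 0)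
      ≤⟨ +-mono-≤ (∑ˢ-mono-≤ n (λ χ → *-mono-≤ (bit≤1 (within v (∁ χ))) (bit≤1 (within w (∁ χ)))))
                  (∑ˢ-mono-≤ n (λ χ → +-monoˡ-≤ 0 (*-mono-≤ (bit≤1 (within v χ)) (bit≤1 (within w χ))))) ⟩
    ∑ˢ n (λ _ → 1) + ∑ˢ n (λ _ → 1)
      ≡⟨ cong₂ _+_ (∑ˢ-const n 1) (∑ˢ-const n 1) ⟩
    2 ^ n * 1 + 2 ^ n * 1
      ≡⟨ eq (2 ^ n) ⟩
    2 * 2 ^ n * 1
      ≤⟨ *-monoʳ-≤ (2 * 2 ^ n) {y = suc ∣ v ∩ w ∣} (s≤s z≤n) ⟩
    2 * 2 ^ n * suc ∣ v ∩ w ∣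
      ≤⟨ m≤n+m _ _ ⟩
    ∑ˢ n (λ χ → inᴮ v χ * 0) + ∑ˢ n (λ χ → inᴬ v χ * 0 + 0) + 2 * 2 ^ n * suc ∣ v ∩ w ∣ ∎
    where
    open ≤-Reasoning
    eq : ∀ p → p * 1 + p * 1 ≡ 2 * p * 1
    eq = solve-∀

  countᴬ countᴮ : ∀ {m n} → (Fin m → Subset n) → Subset n → ℕ
  countᴬ M χ = sum (λ x → inᴬ (M x) χ)
  countᴮ M χ = sum (λ x → inᴮ (M x) χ)

  module Splitting {m n r K : ℕ} (M : Fin m → Subset n) (∣M∣≤r : ∀ x → ∣ M x ∣ ≤ r)
                   (overlap≤K : ∀ x → sum (λ y → ∣ M x ∩ M y ∣) ≤ K) where

    R = 2 ^ r

    -- This is `E (a - b)² ≤ m K`. Expanded into pairs of variables, the squares become `same` and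
    -- `2 a b` becomes `cross`, where the pairwise estimate applies.
    second-moment : ∑ˢ n (λ χ → countᴬ M χ * countᴬ M χ + countᴮ M χ * countᴮ M χ) ≤
                    ∑ˢ n (λ χ → 2 * (countᴬ M χ * countᴮ M χ)) + 2 ^ n * (m * K)
    second-moment = begin
      ∑ˢ n (λ χ → countᴬ M χ * countᴬ M χ + countᴮ M χ * countᴮ M χ)
        ≡⟨ ∑ˢ-cong n (λ χ → trans (cong₂ _+_ (sum-*-sum (λ x → inᴬ (M x) χ) (λ x → inᴬ (M x) χ))
                                             (sum-*-sum (λ x → inᴮ (M x) χ) (λ x → inᴮ (M x) χ)))
                                  (sym (sum-sum-+ (λ x y → inᴬ (M x) χ * inᴬ (M y) χ)
                                                  (λ x y → inᴮ (M x) χ * inᴮ (M y) χ)))) ⟩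
      ∑ˢ n (λ χ → sum (λ x → sum (λ y → same (M x) (M y) χ)))
        ≡⟨ ∑ˢ-sum² (λ x y → same (M x) (M y)) ⟩
      sum (λ x → sum (λ y → ∑ˢ n (same (M x) (M y))))
        ≤⟨ sum-mono-≤ (λ x → sum-mono-≤ (λ y → ∑ˢ-same≤cross (M x) (M y))) ⟩
      sum (λ x → sum (λ y → ∑ˢ n (cross (M x) (M y)) + 2 ^ n * ∣ M x ∩ M y ∣))
        ≡⟨ sum-sum-+ (λ x y → ∑ˢ n (cross (M x) (M y))) (λ x y → 2 ^ n * ∣ M x ∩ M y ∣) ⟩
      sum (λ x → sum (λ y → ∑ˢ n (cross (M x) (M y)))) + sum (λ x → sum (λ y → 2 ^ n * ∣ M x ∩ M y ∣))
        ≤⟨ +-mono-≤ (≤-reflexive (sym (∑ˢ-sum² (λ x y → cross (M x) (M y))))) overlaps ⟩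
      ∑ˢ n (λ χ → sum (λ x → sum (λ y → cross (M x) (M y) χ))) + 2 ^ n * (m * K)
        ≡⟨ cong (_+ _) (∑ˢ-cong n cross-sum) ⟩
      ∑ˢ n (λ χ → 2 * (countᴬ M χ * countᴮ M χ)) + 2 ^ n * (m * K) ∎
      where
      open ≤-Reasoning
      ∑ˢ-sum² : (f : Fin m → Fin m → Subset n → ℕ) →
                ∑ˢ n (λ χ → sum (λ x → sum (λ y → f x y χ))) ≡ sum (λ x → sum (λ y → ∑ˢ n (f x y)))
      ∑ˢ-sum² f = trans (∑ˢ-sum n (λ x χ → sum (λ y → f x y χ))) (sum-cong-≗ (λ x → ∑ˢ-sum n (f x)))
      overlaps : sum (λ x → sum (λ y → 2 ^ n * ∣ M x ∩ M y ∣)) ≤ 2 ^ n * (m * K)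
      overlaps = begin
        sum (λ x → sum (λ y → 2 ^ n * ∣ M x ∩ M y ∣))
          ≡⟨ sum-cong-≗ (λ x → *-distribˡ-sum (2 ^ n) (λ y → ∣ M x ∩ M y ∣)) ⟨
        sum (λ x → 2 ^ n * sum (λ y → ∣ M x ∩ M y ∣))
          ≡⟨ *-distribˡ-sum (2 ^ n) (λ x → sum (λ y → ∣ M x ∩ M y ∣)) ⟨
        2 ^ n * sum (λ x → sum (λ y → ∣ M x ∩ M y ∣))
          ≤⟨ *-monoʳ-≤ (2 ^ n) (sum-mono-≤ overlap≤K) ⟩
        2 ^ n * sum {m} (λ _ → K)
          ≡⟨ cong (2 ^ n *_) (sum-const m K) ⟩
        2 ^ n * (m * K) ∎
      cross-sum : ∀ χ → sum (λ x → sum (λ y → cross (M x) (M y) χ)) ≡ 2 * (countᴬ M χ * countᴮ M χ)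
      cross-sum χ = begin-equality
        sum (λ x → sum (λ y → cross (M x) (M y) χ))
          ≡⟨ sum-sum-+ (λ x y → inᴬ (M x) χ * inᴮ (M y) χ) (λ x y → inᴮ (M x) χ * inᴬ (M y) χ) ⟩
        sum (λ x → sum (λ y → inᴬ (M x) χ * inᴮ (M y) χ)) + sum (λ x → sum (λ y → inᴮ (M x) χ * inᴬ (M y) χ))
          ≡⟨ cong₂ _+_ (sum-*-sum (λ x → inᴬ (M x) χ) (λ x → inᴮ (M x) χ))
                       (sum-*-sum (λ x → inᴮ (M x) χ) (λ x → inᴬ (M x) χ)) ⟨
        countᴬ M χ * countᴮ M χ + countᴮ M χ * countᴬ M χ
          ≡⟨ eq (countᴬ M χ) (countᴮ M χ) ⟩
        2 * (countᴬ M χ * countᴮ M χ) ∎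
        where
        eq : ∀ a b → a * b + b * a ≡ 2 * (a * b)
        eq = solve-∀

    first-moment : 2 ^ n * (2 * m) ≤ ∑ˢ n (λ χ → R * (countᴬ M χ + countᴮ M χ))
    first-moment = begin
      2 ^ n * (2 * m)                                       ≡⟨ eq (2 ^ n) m ⟩
      m * 2 ^ n + m * 2 ^ n                                 ≡⟨ cong₂ _+_ (sum-const m (2 ^ n)) (sum-const m (2 ^ n)) ⟨
      sum {m} (λ _ → 2 ^ n) + sum {m} (λ _ → 2 ^ n)
        ≤⟨ +-mono-≤ (sum-mono-≤ (λ x → ≤-trans (2^n≤2^∣v∣*∑ˢinᴬ (M x)) (2^∣M∣≤R x _)))
                    (sum-mono-≤ (λ x → ≤-trans (2^n≤2^∣v∣*∑ˢinᴮ (M x)) (2^∣M∣≤R x _))) ⟩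
      sum (λ x → R * ∑ˢ n (inᴬ (M x))) + sum (λ x → R * ∑ˢ n (inᴮ (M x)))
        ≡⟨ cong₂ _+_ (*-distribˡ-sum R (λ x → ∑ˢ n (inᴬ (M x)))) (*-distribˡ-sum R (λ x → ∑ˢ n (inᴮ (M x)))) ⟨
      R * sum (λ x → ∑ˢ n (inᴬ (M x))) + R * sum (λ x → ∑ˢ n (inᴮ (M x)))
        ≡⟨ cong₂ (λ a b → R * a + R * b) (∑ˢ-sum n (inᴬ ∘ M)) (∑ˢ-sum n (inᴮ ∘ M)) ⟨
      R * ∑ˢ n (countᴬ M) + R * ∑ˢ n (countᴮ M)             ≡⟨ *-distribˡ-+ R _ _ ⟨
      R * (∑ˢ n (countᴬ M) + ∑ˢ n (countᴮ M))               ≡⟨ cong (R *_) (∑ˢ-+ n (countᴬ M) (countᴮ M)) ⟨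
      R * ∑ˢ n (λ χ → countᴬ M χ + countᴮ M χ)              ≡⟨ ∑ˢ-* n R (λ χ → countᴬ M χ + countᴮ M χ) ⟨
      ∑ˢ n (λ χ → R * (countᴬ M χ + countᴮ M χ))            ∎
      where
      open ≤-Reasoning
      eq : ∀ p m → p * (2 * m) ≡ m * p + m * p
      eq = solve-∀
      2^∣M∣≤R : ∀ x c → 2 ^ ∣ M x ∣ * c ≤ R * c
      2^∣M∣≤R x c = *-monoˡ-≤ c (^-monoʳ-≤ 2 (∣M∣≤r x))

    -- t weighs the expected counts against the variance of their difference.
    ∃-balanced : ∀ t → ∃[ χ ]
      countᴬ M χ * countᴬ M χ + countᴮ M χ * countᴮ M χ + t * (2 * m) ≤
      2 * (countᴬ M χ * countᴮ M χ) + m * K + t * (R * (countᴬ M χ + countᴮ M χ))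
    ∃-balanced t = ∑ˢ-≤⇒∃≤ n (begin
      ∑ˢ n (λ χ → sq χ + t * (2 * m))                     ≡⟨ ∑ˢ-+ n sq _ ⟩
      ∑ˢ n sq + ∑ˢ n (λ _ → t * (2 * m))                  ≡⟨ cong (∑ˢ n sq +_) (∑ˢ-* n t (λ _ → 2 * m)) ⟩
      ∑ˢ n sq + t * ∑ˢ n (λ _ → 2 * m)
        ≤⟨ +-mono-≤ second-moment (*-monoʳ-≤ t (≤-trans (≤-reflexive (∑ˢ-const n (2 * m))) first-moment)) ⟩
      ∑ˢ n ab + 2 ^ n * (m * K) + t * ∑ˢ n a+b            ≡⟨ cong₂ (λ p q → ∑ˢ n ab + p + q) (∑ˢ-const n (m * K)) (∑ˢ-* n t a+b) ⟨
      ∑ˢ n ab + ∑ˢ n (λ _ → m * K) + ∑ˢ n (λ χ → t * a+b χ)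
        ≡⟨ cong (_+ ∑ˢ n (λ χ → t * a+b χ)) (∑ˢ-+ n ab (λ _ → m * K)) ⟨
      ∑ˢ n (λ χ → ab χ + m * K) + ∑ˢ n (λ χ → t * a+b χ)  ≡⟨ ∑ˢ-+ n _ _ ⟨
      ∑ˢ n (λ χ → ab χ + m * K + t * a+b χ)               ∎)
      where
      open ≤-Reasoning
      sq ab a+b : Subset n → ℕ
      sq χ  = countᴬ M χ * countᴬ M χ + countᴮ M χ * countᴮ M χ
      ab χ  = 2 * (countᴬ M χ * countᴮ M χ)
      a+b χ = R * (countᴬ M χ + countᴮ M χ)

  -- Decision trees as tree-like resolution

  x∈p─q⇒x∉q : ∀ {n} {x : Fin n} (p q : Subset n) → x ∈ˢ p ─ q → x ∉ˢ q
  x∈p─q⇒x∉q (_ ∷ p) (false ∷ q) here          ()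
  x∈p─q⇒x∉q (_ ∷ p) (_     ∷ q) (there x∈p─q) (there x∈q) = x∈p─q⇒x∉q p q x∈p─q x∈q

  x∉p-x : ∀ {n} {x : Fin n} (p : Subset n) → x ∉ˢ p - x
  x∉p-x {x = x} p x∈ = x∈p─q⇒x∉q p _ x∈ (x∈⁅x⁆ x)

  module _ {m : ℕ} where

    -- The partial assignment along a path is a total `α` with the predicate `Q` of the queried
    -- variables; values of `α` outside `Q` must not be used.
    record Falsified (Q : Fin m → Set) (α : Assignment m) (C : Clause m) : Set where
      constructor falsified
      field
        on-pos : ∀ {y} → y ∈ˢ pos C → Q y × lookup α y ≡ false
        on-neg : ∀ {y} → y ∈ˢ neg C → Q y × lookup α y ≡ true

    -- The strict bound absorbs the inner nodes: `size + 1` adds up over the two premises of a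
    -- resolution step. A leaf already needs `s = 1`, so `s` is the depth plus one.
    record Refutable (F : CNF m) (s : ℕ) (Q : Fin m → Set) (α : Assignment m) : Set where
      constructor refutable
      field
        {C}        : Clause m
        derivation : F ⊢ C
        bound      : size derivation < 2 ^ s
        conflict   : Falsified Q α C

    Refutable-mono : ∀ {F s s′ Q Q′ α} → s ≤ s′ → (∀ {y} → Q y → Q′ y) →
                     Refutable F s Q α → Refutable F s′ Q′ α
    Refutable-mono s≤s′ Q⊆Q′ (refutable π π< (falsified p n)) =
      refutable π (≤-trans π< (^-monoʳ-≤ 2 s≤s′))
        (falsified (λ y∈ → let q , e = p y∈ in Q⊆Q′ q , e) (λ y∈ → let q , e = n y∈ in Q⊆Q′ q , e))

    -- Both clauses are falsified once x is queried; either one of them does not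
    -- mention x, or they clash in x.
    branch : ∀ {F s Q α} x →
             (∀ b → Refutable F s (λ y → y ≡ x ⊎ Q y) (α [ x ]≔ b)) → Refutable F (suc s) Q α
    branch {F} {s} {Q} {α} x refute with refute false | refute true
    ... | refutable {C} π π< (falsified pC nC) | refutable {D} ρ ρ< (falsified pD nD) = result
      where
      drop-x : ∀ {y b c} → y ≢ x → (y ≡ x ⊎ Q y) × lookup (α [ x ]≔ b) y ≡ c → Q y × lookup α y ≡ c
      drop-x y≢x (inj₁ y≡x , _) = contradiction y≡x y≢x
      drop-x y≢x (inj₂ q   , e) = q , trans (sym (lookup∘update′ y≢x α _)) e

      value-x : ∀ {y b c} → y ≡ x → lookup (α [ x ]≔ b) y ≡ c → b ≡ c
      value-x refl e = trans (sym (lookup∘update x α _)) e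

      -- `D` is falsified with `x` true, so `x` cannot occur in it positively, nor in `C`
      -- negatively; hence resolving on `x` leaves no occurrence of `x`.
      pos-D : ∀ {y} → y ∈ˢ pos D → y ≢ x
      pos-D y∈ y≡x with value-x y≡x (proj₂ (pD y∈))
      ... | ()

      neg-C : ∀ {y} → y ∈ˢ neg C → y ≢ x
      neg-C y∈ y≡x with value-x y≡x (proj₂ (nC y∈))
      ... | ()

      weaken : ∀ {k} → k < 2 ^ s → k < 2 ^ suc s
      weaken k< = ≤-trans k< (m≤m+n (2 ^ s) _)

      size-< : suc (size π + size ρ) < 2 ^ suc s
      size-< = begin
        suc (suc (size π + size ρ))      ≡⟨ cong suc (+-suc (size π) (size ρ)) ⟨
        suc (size π) + suc (size ρ)      ≤⟨ +-mono-≤ π< ρ< ⟩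
        2 ^ s + 2 ^ s                    ≡⟨ cong (2 ^ s +_) (+-identityʳ (2 ^ s)) ⟨
        2 ^ suc s                        ∎
        where open ≤-Reasoning

      result : Refutable F (suc s) Q α
      result with x ∈? pos C | x ∈? neg D
      ... | no x∉C | _ = refutable π (weaken π<) (falsified
        (λ y∈ → drop-x (λ { refl → x∉C y∈ }) (pC y∈))
        (λ y∈ → drop-x (neg-C y∈) (nC y∈)))
      ... | yes _ | no x∉D = refutable ρ (weaken ρ<) (falsified
        (λ y∈ → drop-x (pos-D y∈) (pD y∈))
        (λ y∈ → drop-x (λ { refl → x∉D y∈ }) (nD y∈)))
      ... | yes x∈C | yes x∈D = refutable (resolve x x∈C x∈D π ρ) size-< (falsified
        (λ y∈ → [ (λ y∈C → drop-x (λ { refl → x∉p-x (pos C) y∈C }) (pC (p─q⊆p (pos C) _ y∈C)))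
                , (λ y∈D → drop-x (pos-D y∈D) (pD y∈D)) ]′ (x∈p∪q⁻ (pos C - x) (pos D) y∈))
        (λ y∈ → [ (λ y∈C → drop-x (neg-C y∈C) (nC y∈C))
                , (λ y∈D → drop-x (λ { refl → x∉p-x (neg D) y∈D }) (nD (p─q⊆p (neg D) _ y∈D))) ]′
                (x∈p∪q⁻ (neg C) (neg D - x) y∈)))

    AgreeOff : List (Fin m) → Assignment m → Assignment m → Set
    AgreeOff xs α β = ∀ y → y ∉ xs → lookup β y ≡ lookup α y

    -- P is an escape: the search aborts at the first leaf that returns P.
    queryAll : ∀ {F s} {P : Set} xs Q α →
               (∀ β → AgreeOff xs α β → P ⊎ Refutable F s (λ y → y ∈ xs ⊎ Q y) β) →
               P ⊎ Refutable F (length xs + s) Q α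
    queryAll []       Q α leaf with leaf α (λ _ _ → refl)
    ... | inj₁ p = inj₁ p
    ... | inj₂ r = inj₂ (Refutable-mono ≤-refl (λ { (inj₂ q) → q }) r)
    queryAll {F} {s} {P} (x ∷ xs) Q α leaf with sub false | sub true
      where
      sub : ∀ b → P ⊎ Refutable F (length xs + s) (λ y → y ≡ x ⊎ Q y) (α [ x ]≔ b)
      sub b = queryAll xs _ (α [ x ]≔ b) λ β agree →
        [ inj₁ , inj₂ ∘ Refutable-mono ≤-refl
            (λ { (inj₁ (here e)) → inj₂ (inj₁ e) ; (inj₁ (there ∈)) → inj₁ ∈ ; (inj₂ q) → inj₂ (inj₂ q) }) ]′
        (leaf β (λ y y∉ → trans (agree y (y∉ ∘ there)) (lookup∘update′ (λ e → y∉ (here e)) α b)))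
    ... | inj₁ p | _      = inj₁ p
    ... | inj₂ _ | inj₁ p = inj₁ p
    ... | inj₂ f | inj₂ t = inj₂ (branch x (λ { false → f ; true → t }))

    -- A clause falsified before any query has no literals.
    Refutable-∅⇒refutation : ∀ {F s α} → Refutable F s (λ _ → ⊥) α →
                             Σ[ π ∈ TreeRefutation F ] size π < 2 ^ s
    Refutable-∅⇒refutation (refutable {clause p n} π π< (falsified fp fn))
      with refl ← Empty-unique {p = p} (λ (_ , y∈) → proj₁ (fp y∈))
         | refl ← Empty-unique {p = n} (λ (_ , y∈) → proj₁ (fn y∈)) = π , π<

  -- Clauses of violated constraints, and the constraints on a variable

  falsifiedBy-pos : ∀ {m} (S : Subset m) α {y} → y ∈ˢ pos (falsifiedBy S (restrict S α)) →
                    y ∈ˢ S × lookup α y ≡ false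
  falsifiedBy-pos (true  ∷ S) (false ∷ α) here       = here , refl
  falsifiedBy-pos (true  ∷ S) (_     ∷ α) (there y∈) =
    let y∈S , e = falsifiedBy-pos S α y∈ in there y∈S , e
  falsifiedBy-pos (false ∷ S) (_     ∷ α) (there y∈) =
    let y∈S , e = falsifiedBy-pos S α y∈ in there y∈S , e

  falsifiedBy-neg : ∀ {m} (S : Subset m) α {y} → y ∈ˢ neg (falsifiedBy S (restrict S α)) →
                    y ∈ˢ S × lookup α y ≡ true
  falsifiedBy-neg (true  ∷ S) (true ∷ α) here       = here , refl
  falsifiedBy-neg (true  ∷ S) (_    ∷ α) (there y∈) =
    let y∈S , e = falsifiedBy-neg S α y∈ in there y∈S , e
  falsifiedBy-neg (false ∷ S) (_    ∷ α) (there y∈) =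
    let y∈S , e = falsifiedBy-neg S α y∈ in there y∈S , e

  restrict-cong : ∀ {m} (S : Subset m) α β → (∀ {y} → y ∈ˢ S → lookup α y ≡ lookup β y) →
                  restrict S α ≡ restrict S β
  restrict-cong []          []      []      _ = refl
  restrict-cong (true  ∷ S) (a ∷ α) (b ∷ β) e = cong₂ _∷_ (e here) (restrict-cong S α β (e ∘ there))
  restrict-cong (false ∷ S) (a ∷ α) (b ∷ β) e = restrict-cong S α β (e ∘ there)

  ∈-allVecs : ∀ {n} (v : Vec Bool n) → v ∈ allVecs n
  ∈-allVecs []      = here refl
  ∈-allVecs (b ∷ v) = ∈-cartesianProductWith⁺ _∷_ (∈-bools b) (∈-allVecs v)
    where
    ∈-bools : ∀ b → b ∈ false ∷ true ∷ []
    ∈-bools false = here refl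
    ∈-bools true  = there (here refl)

  violated⇒∈cnf : ∀ {m k} {Ψ : CSP m k} {c} α → c ∈ Ψ → allows c (restrict (vars c) α) ≡ false →
                  falsifiedBy (vars c) (restrict (vars c) α) ∈ cnf Ψ
  violated⇒∈cnf {c = c} α c∈Ψ violated = ∈-concatMap⁺ constraintCNF
    (Any.map (λ { refl → ∈-map⁺ (falsifiedBy (vars c))
                   (∈-filter⁺ (λ β → allows c β ≟ᵇ false) (∈-allVecs _) violated) }) c∈Ψ)

  -- A row of the incidence matrix. It is indexed by positions in the list, so repeated constraints
  -- are coloured separately.
  mask : ∀ {m k} (Ψ : CSP m k) → Fin m → Subset (length Ψ)
  mask []      y = []
  mask (c ∷ Ψ) y = lookup (vars c) y ∷ mask Ψ y

  ∈-mask : ∀ {m k} (Ψ : CSP m k) {y} i → y ∈ˢ vars (lookupᴸ Ψ i) → i ∈ˢ mask Ψ y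
  ∈-mask (c ∷ Ψ) zero    y∈ = lookup⇒[]= zero _ ([]=⇒lookup y∈)
  ∈-mask (c ∷ Ψ) (suc i) y∈ = there (∈-mask Ψ i y∈)

  within-⊆ : ∀ {n} (v χ : Subset n) {i} → within v χ ≡ true → i ∈ˢ v → lookup χ i ≡ true
  within-⊆ (true  ∷ v) (true ∷ χ) w here       = refl
  within-⊆ (true  ∷ v) (true ∷ χ) w (there i∈) = within-⊆ v χ w i∈
  within-⊆ (false ∷ v) (_    ∷ χ) w (there i∈) = within-⊆ v χ w i∈

  select : ∀ {m} → (Fin m → Bool) → List (Fin m)
  select p = filter (λ y → p y ≟ᵇ true) (allFin _)

  ∈-select⁺ : ∀ {m} {p : Fin m → Bool} {y} → p y ≡ true → y ∈ select p
  ∈-select⁺ {p = p} {y} = ∈-filter⁺ (λ y → p y ≟ᵇ true) (∈-allFin y)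

  ∈-select⁻ : ∀ {m} {p : Fin m → Bool} {y} → y ∈ select p → p y ≡ true
  ∈-select⁻ {p = p} y∈ = proj₂ (∈-filter⁻ (λ y → p y ≟ᵇ true) {xs = allFin _} y∈)

  length-select : ∀ {m} (p : Fin m → Bool) → length (select p) ≡ sum (bit ∘ p)
  length-select p = go p id
    where
    -- `allFin` is `tabulateᴸ id`; the induction needs an arbitrary `f` in place of `id`.
    go : ∀ {m n} (p : Fin m → Bool) (f : Fin n → Fin m) →
         length (filter (λ y → p y ≟ᵇ true) (tabulateᴸ f)) ≡ sum (bit ∘ p ∘ f)
    go {n = zero}  p f = refl
    go {n = suc n} p f with p (f zero)
    ... | true  = cong suc (go p (f ∘ suc))
    ... | false = go p (f ∘ suc)

  -- The decision tree of a two-coloured CSP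

  module _ {m k : ℕ} (Ψ : CSP m k) (unsat : Unsatisfiable Ψ) (χ : Subset (length Ψ)) where

    private
      con : Fin (length Ψ) → Constraint m k
      con = lookupᴸ Ψ

      AllowsAt : Assignment m → Fin (length Ψ) → Bool
      AllowsAt α i = allows (con i) (restrict (vars (con i)) α)

      -- Occurrence in colour `s` is phrased as not lying within the other colour, so that
      -- `bit (not (meets s y))` is, up to double negation, a summand of `countᴮ` for `true` and of
      -- `countᴬ` for `false`.
      meets : Bool → Fin m → Bool
      meets true  y = not (within (mask Ψ y) (∁ χ))
      meets false y = not (within (mask Ψ y) χ)

      shared : List (Fin m)
      shared = select (λ y → meets true y ∧ meets false y)

      private-to : Bool → List (Fin m)
      private-to s = select (λ y → meets s y ∧ not (meets (not s) y))

      meets-∈ : ∀ {y} i → y ∈ˢ vars (con i) → meets (lookup χ i) y ≡ true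
      meets-∈ {y} i y∈ with lookup χ i in eq
      ... | true with within (mask Ψ y) (∁ χ) in w
      ...   | false = refl
      ...   | true  with trans (sym (within-⊆ (mask Ψ y) (∁ χ) w (∈-mask Ψ i y∈))) (trans (lookup-map i not χ) (cong not eq))
      ...     | ()
      meets-∈ {y} i y∈ | false with within (mask Ψ y) χ in w
      ...   | false = refl
      ...   | true  with trans (sym (within-⊆ (mask Ψ y) χ w (∈-mask Ψ i y∈))) eq
      ...     | ()

      queried : ∀ {y} s i → lookup χ i ≡ s → y ∈ˢ vars (con i) → y ∈ private-to s ⊎ y ∈ shared
      queried {y} s i refl y∈ = go (lookup χ i) (meets-∈ i y∈)
        where
        go : ∀ s → meets s y ≡ true → y ∈ private-to s ⊎ y ∈ shared
        go true e with meets false y in e′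
        ... | true  = inj₂ (∈-select⁺ (cong₂ _∧_ e e′))
        ... | false = inj₁ (∈-select⁺ (cong₂ (λ a b → a ∧ not b) e e′))
        go false e with meets true y in e′
        ... | true  = inj₂ (∈-select⁺ (cong₂ _∧_ e′ e))
        ... | false = inj₁ (∈-select⁺ (cong₂ (λ a b → a ∧ not b) e e′))

      not-private : ∀ {y} s i → lookup χ i ≡ s → y ∈ˢ vars (con i) → y ∉ private-to (not s)
      not-private {y} s i refl y∈ y∈′ = go (meets (not s) y) (meets (not (not s)) y) (∈-select⁻ y∈′)
        (trans (cong (λ b → meets b y) (not-involutive s)) (meets-∈ i y∈))
        where
        go : ∀ a b → a ∧ not b ≡ true → b ≢ true
        go true false _ ()

      Satisfied : Bool → Assignment m → Set
      Satisfied s α = ∀ i → lookup χ i ≡ s → AllowsAt α i ≡ true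

      -- A violated constraint of colour `s` has only queried variables, so its clause can label the
      -- leaf; the exponent 1 is the least with `1 < 2 ^ 1`.
      refute-or-satisfy : ∀ s α → Satisfied s α ⊎
                          Refutable (cnf Ψ) 1 (λ y → y ∈ private-to s ⊎ y ∈ shared) α
      refute-or-satisfy s α with any? (λ i → (lookup χ i ≟ᵇ s) ×-dec (AllowsAt α i ≟ᵇ false))
      ... | yes (i , side , violated) = inj₂
        (refutable (axiom (violated⇒∈cnf α (∈-lookup {xs = Ψ} i) violated)) ≤-refl (falsified
          (λ y∈ → let y∈S , e = falsifiedBy-pos (vars (con i)) α y∈ in queried s i side y∈S , e)
          (λ y∈ → let y∈S , e = falsifiedBy-neg (vars (con i)) α y∈ in queried s i side y∈S , e)))
      ... | no none = inj₁ satisfied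
        where
        satisfied : Satisfied s α
        satisfied i side with AllowsAt α i in e
        ... | true  = refl
        ... | false = contradiction (i , side , e) none

      len : Bool → ℕ
      len s = length (private-to s)

      refute-side : ∀ s {P : Set} β →
                    (∀ α → AgreeOff (private-to s) β α → Satisfied s α → P) →
                    P ⊎ Refutable (cnf Ψ) (len true ⊔ len false + 1) (_∈ shared) β
      refute-side s β escape =
        [ inj₁ , inj₂ ∘ Refutable-mono (+-monoˡ-≤ 1 (len≤ s)) id ]′
        (queryAll (private-to s) (_∈ shared) β λ α agree →
          [ inj₁ ∘ escape α agree , inj₂ ]′ (refute-or-satisfy s α))
        where
        len≤ : ∀ s → len s ≤ len true ⊔ len false
        len≤ true  = m≤m⊔n _ _
        len≤ false = m≤n⊔m (len true) _

      -- The two sides share no variable off `shared`, so partial solutions glue.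
      glue : ∀ β α₁ α₂ → AgreeOff (private-to true) β α₁ → Satisfied true α₁ →
             AgreeOff (private-to false) β α₂ → Satisfied false α₂ → ⊥
      glue β α₁ α₂ agree₁ sat₁ agree₂ sat₂ = unsat γ
        (All-tabulate λ c∈Ψ → subst (λ c → allows c (restrict (vars c) γ) ≡ true)
          (sym (lookup-index c∈Ψ)) (satγ (index c∈Ψ)))
        where
        value : Fin m → Bool
        -- On side `false` it suffices that no variable is private to `true`. On side `true`, a
        -- variable that is not private is private to neither side, and there `α₁` and `α₂` both
        -- keep the value of `β`.
        value y = if does (DecMembership._∈?_ _≟ᶠ_ y (private-to true)) then lookup α₁ y else lookup α₂ y
        γ = tabulate value
        value₁ : ∀ {y} i → lookup χ i ≡ true → y ∈ˢ vars (con i) → value y ≡ lookup α₁ y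
        value₁ {y} i side y∈ with DecMembership._∈?_ _≟ᶠ_ y (private-to true)
        ... | yes _ = refl
        ... | no y∉ = trans (agree₂ y (not-private true i side y∈)) (sym (agree₁ y y∉))
        value₂ : ∀ {y} i → lookup χ i ≡ false → y ∈ˢ vars (con i) → value y ≡ lookup α₂ y
        value₂ {y} i side y∈ with DecMembership._∈?_ _≟ᶠ_ y (private-to true)
        ... | yes y∈′ = contradiction y∈′ (not-private false i side y∈)
        ... | no _    = refl
        satγ : ∀ i → AllowsAt γ i ≡ true
        satγ i with lookup χ i in side
        ... | true  = trans (cong (allows (con i)) (restrict-cong (vars (con i)) γ α₁
                        (λ {y} y∈ → trans (lookup∘tabulate value y) (value₁ i side y∈)))) (sat₁ i side)
        ... | false = trans (cong (allows (con i)) (restrict-cong (vars (con i)) γ α₂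
                        (λ {y} y∈ → trans (lookup∘tabulate value y) (value₂ i side y∈)))) (sat₂ i side)

      -- The escape from side `true` carries a solution of that side extending `β` on the shared
      -- variables. With it at hand, an escape from side `false` is absurd by `glue`, so that side
      -- is refuted.
      tree : ⊥ ⊎ Refutable (cnf Ψ) (length shared + (len true ⊔ len false + 1)) (λ _ → ⊥) (replicate m false)
      tree = queryAll shared (λ _ → ⊥) (replicate m false) λ β _ → inj₂ (Refutable-mono ≤-refl inj₁
        ([ (λ (α₁ , agree₁ , sat₁) →
             [ ⊥-elim , id ]′ (refute-side false β λ α₂ agree₂ sat₂ → glue β α₁ α₂ agree₁ sat₁ agree₂ sat₂))
         , id ]′
         (refute-side true β λ α₁ agree₁ sat₁ → α₁ , agree₁ , sat₁)))

      count : ∀ s → length shared + len s + sum (λ y → bit (not (meets s y))) ≡ m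
      count s = begin
        length shared + len s + rest
          ≡⟨ cong₂ (λ p q → p + q + rest) (length-select (λ y → meets true y ∧ meets false y))
                                         (length-select (λ y → meets s y ∧ not (meets (not s) y))) ⟩
        sum (λ y → both y) + sum (λ y → only y) + rest
          ≡⟨ cong (_+ rest) (∑-distrib-+ both only) ⟨
        sum (λ y → both y + only y) + sum (λ y → bit (not (meets s y)))
          ≡⟨ ∑-distrib-+ (λ y → both y + only y) _ ⟨
        sum (λ y → both y + only y + bit (not (meets s y)))
          ≡⟨ sum-cong-≗ (λ y → one s (meets true y) (meets false y) (meets s y) (meets (not s) y) (pick s y)) ⟩
        sum {m} (λ _ → 1)
          ≡⟨ trans (sum-const m 1) (*-identityʳ m) ⟩
        m ∎
        where
        open ≡-Reasoning
        both only : Fin m → ℕ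
        both y = bit (meets true y ∧ meets false y)
        only y = bit (meets s y ∧ not (meets (not s) y))
        rest = sum (λ y → bit (not (meets s y)))
        -- Identifies `meets s` and `meets (not s)` with the two colours in the right order, which
        -- reduces `one` to a truth table.
        pick : ∀ s y → (meets s y , meets (not s) y) ≡
                       (if s then (meets true y , meets false y) else (meets false y , meets true y))
        pick true  y = refl
        pick false y = refl
        one : ∀ s t f a b → (a , b) ≡ (if s then (t , f) else (f , t)) →
              bit (t ∧ f) + bit (a ∧ not b) + bit (not a) ≡ 1
        one true  true  true  _ _ refl = refl
        one true  true  false _ _ refl = refl
        one true  false true  _ _ refl = refl
        one true  false false _ _ refl = refl
        one false true  true  _ _ refl = refl
        one false true  false _ _ refl = refl
        one false false true  _ _ refl = refl
        one false false false _ _ refl = refl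

    -- The branches that refute side `true` skip every variable counted by `countᴮ`, those that
    -- refute side `false` every variable counted by `countᴬ`. The depth is thus at most `m ∸ a`,
    -- and the leaf contributes the extra 1.
    refutation-of-split : ∀ {a} → a ≤ countᴬ (mask Ψ) χ → a ≤ countᴮ (mask Ψ) χ →
                          Σ[ π ∈ TreeRefutation (cnf Ψ) ] size π < 2 ^ (suc m ∸ a)
    refutation-of-split {a} a≤A a≤B with [ ⊥-elim , id ]′ tree
    ... | r = Refutable-∅⇒refutation (Refutable-mono depth≤ id r)
      where
      side≤ : ∀ s → a ≤ sum (λ y → bit (not (meets s y))) → len s ≤ m ∸ a ∸ length shared
      side≤ s a≤ = begin
        len s                                        ≡⟨ m+n∸m≡n (length shared) (len s) ⟨
        length shared + len s ∸ length shared        ≤⟨ ∸-monoˡ-≤ (length shared) (m+n≤o⇒m≤o∸n _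
          (≤-trans (+-monoʳ-≤ (length shared + len s) a≤) (≤-reflexive (count s)))) ⟩
        m ∸ a ∸ length shared ∎
        where open ≤-Reasoning
      bits : ∀ {p : Fin m → Bool} → sum (λ y → bit (not (not (p y)))) ≡ sum (λ y → bit (p y))
      bits {p} = sum-cong-≗ (λ y → cong bit (not-involutive (p y)))
      A≤ : a ≤ sum (λ y → bit (not (meets false y)))
      A≤ = ≤-trans a≤A (≤-reflexive (sym bits))
      B≤ : a ≤ sum (λ y → bit (not (meets true y)))
      B≤ = ≤-trans a≤B (≤-reflexive (sym bits))
      shared≤ : length shared ≤ m ∸ a
      shared≤ = m+n≤o⇒m≤o∸n _ (≤-trans (+-mono-≤ (m≤m+n (length shared) (len true)) B≤)
                                       (≤-reflexive (count true)))
      depth≤ : length shared + (len true ⊔ len false + 1) ≤ suc m ∸ a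
      depth≤ = begin
        length shared + (len true ⊔ len false + 1)
          ≤⟨ +-monoʳ-≤ (length shared) (+-monoˡ-≤ 1 (⊔-lub (side≤ true B≤) (side≤ false A≤))) ⟩
        length shared + (m ∸ a ∸ length shared + 1)  ≡⟨ +-assoc (length shared) _ 1 ⟨
        length shared + (m ∸ a ∸ length shared) + 1  ≡⟨ cong (_+ 1) (m+[n∸m]≡n shared≤) ⟩
        m ∸ a + 1                                    ≡⟨ +-∸-comm 1 a≤m ⟨
        m + 1 ∸ a                                    ≡⟨ cong (_∸ a) (+-comm m 1) ⟩
        suc m ∸ a                                    ∎
        where
        open ≤-Reasoning
        a≤m : a ≤ m
        a≤m = ≤-trans B≤ (≤-trans (m≤n+m _ _) (≤-reflexive (count true)))

  -- Frequency and overlap of the constraint sets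

  ∣mask∣≡occurrences : ∀ {m k} (Ψ : CSP m k) y → ∣ mask Ψ y ∣ ≡ occurrences Ψ y
  ∣mask∣≡occurrences []      y = refl
  ∣mask∣≡occurrences (c ∷ Ψ) y with y ∈? vars c | lookup (vars c) y in eq
  ... | yes _   | true  = cong suc (∣mask∣≡occurrences Ψ y)
  ... | no _    | false = ∣mask∣≡occurrences Ψ y
  ... | yes y∈c | false = contradiction (trans (sym ([]=⇒lookup y∈c)) eq) λ ()
  ... | no y∉c  | true  = contradiction (lookup⇒[]= y (vars c) eq) y∉c

  ∣mask∣≤frequency : ∀ {m k} (Ψ : CSP m k) y → ∣ mask Ψ y ∣ ≤ variableFrequency Ψ
  ∣mask∣≤frequency Ψ y = ≤-trans (≤-reflexive (∣mask∣≡occurrences Ψ y))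
    (All-lookup (xs≤max 0 (map (occurrences Ψ) (allFin _))) (∈-map⁺ (occurrences Ψ) (∈-allFin y)))

  sum-lookup : ∀ {m} (S : Subset m) → sum (λ y → bit (lookup S y)) ≡ ∣ S ∣
  sum-lookup []          = refl
  sum-lookup (true  ∷ S) = cong suc (sum-lookup S)
  sum-lookup (false ∷ S) = sum-lookup S

  -- Double counting: the sum over variables becomes a sum over the constraints in `v`, each with at
  -- most `k` variables.
  overlap≤ : ∀ {m k} (Ψ : CSP m k) v → sum (λ y → ∣ v ∩ mask Ψ y ∣) ≤ ∣ v ∣ * k
  overlap≤ {m} [] [] = ≤-reflexive (trans (sum-const m 0) (*-zeroʳ m))
  overlap≤ (c ∷ Ψ) (false ∷ v) = overlap≤ Ψ v
  overlap≤ {k = k} (c ∷ Ψ) (true ∷ v) = begin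
    sum (λ y → ∣ lookup (vars c) y ∷ v ∩ mask Ψ y ∣)          ≡⟨ sum-cong-≗ (λ y → head-bit (lookup (vars c) y) (v ∩ mask Ψ y)) ⟩
    sum (λ y → bit (lookup (vars c) y) + ∣ v ∩ mask Ψ y ∣)    ≡⟨ ∑-distrib-+ (λ y → bit (lookup (vars c) y)) _ ⟩
    sum (λ y → bit (lookup (vars c) y)) + sum (λ y → ∣ v ∩ mask Ψ y ∣)
      ≤⟨ +-mono-≤ (≤-trans (≤-reflexive (sum-lookup (vars c))) (arity≤k c)) (overlap≤ Ψ v) ⟩
    k + ∣ v ∣ * k ∎
    where
    open ≤-Reasoning
    head-bit : ∀ {n} b (w : Subset n) → ∣ b ∷ w ∣ ≡ bit b + ∣ w ∣
    head-bit true  w = refl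
    head-bit false w = refl

  -- Integer square roots and sublinear functions

  m²≤n²⇒m≤n : ∀ {m n} → m * m ≤ n * n → m ≤ n
  m²≤n²⇒m≤n le = ≮⇒≥ λ n<m → <⇒≱ (*-mono-< n<m n<m) le

  abstract
    -- The witness is the square root rounded up, which grows by at most one when `n` does. The
    -- factor 4 leaves room for the rounding; only the order of magnitude matters.
    ∃√ : ∀ n → ∃[ s ] (n ≤ s * s × s * s ≤ 4 * n)
    ∃√ zero = 0 , z≤n , z≤n
    ∃√ (suc n) with ∃√ n
    ... | s , n≤ , ≤4n with suc n ≤? s * s
    ...   | yes n< = s , n< , ≤-trans ≤4n (*-monoʳ-≤ 4 (n≤1+n n))
    ...   | no n≮  = suc s , lower , upper
      where
      open ≤-Reasoning
      s²≤n : s * s ≤ n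
      s²≤n = s≤s⁻¹ (≰⇒> n≮)
      square : ∀ s → suc s * suc s ≡ suc (s * s) + (s + s)
      square = solve-∀
      lower : suc n ≤ suc s * suc s
      lower = begin
        suc n                    ≤⟨ s≤s n≤ ⟩
        suc (s * s)              ≤⟨ m≤m+n _ _ ⟩
        suc (s * s) + (s + s)    ≡⟨ square s ⟨
        suc s * suc s            ∎
      m≤m² : ∀ m → m ≤ m * m
      m≤m² zero    = z≤n
      m≤m² (suc m) = m≤m+n (suc m) _
      upper : suc s * suc s ≤ 4 * suc n
      upper = begin
        suc s * suc s                    ≡⟨ square s ⟩
        suc (s * s) + (s + s)            ≤⟨ +-mono-≤ (s≤s s²≤n) (+-mono-≤ (≤-trans (m≤m² s) s²≤n) (≤-trans (m≤m² s) s²≤n)) ⟩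
        suc n + (n + n)                  ≤⟨ m≤m+n _ (suc (suc (suc n))) ⟩
        suc n + (n + n) + suc (suc (suc n)) ≡⟨ eq n ⟩
        4 * suc n                        ∎
        where
        eq : ∀ n → suc n + (n + n) + suc (suc (suc n)) ≡ 4 * suc n
        eq = solve-∀

  Sublinear : (ℕ → ℕ) → Set
  Sublinear f = ∀ c → ∃[ M ] (∀ m → M ≤ m → c * f m ≤ m)

  Sublinear-const : ∀ a → Sublinear (λ _ → a)
  Sublinear-const a c = c * a , λ _ M≤m → M≤m

  Sublinear-* : ∀ {f} a → Sublinear f → Sublinear (λ m → f m * a)
  Sublinear-* {f} a f-sub c = let M , le = f-sub (c * a) in M , λ m M≤m →
    ≤-trans (≤-reflexive (eq c (f m) a)) (le m M≤m)
    where
    eq : ∀ c x a → c * (x * a) ≡ c * a * x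
    eq = solve-∀

  Sublinear-+ : ∀ {f g} → Sublinear f → Sublinear g → Sublinear (λ m → f m + g m)
  Sublinear-+ {f} {g} f-sub g-sub c =
    let M , leᶠ = f-sub (2 * c)
        N , leᵍ = g-sub (2 * c)
    in M + N , λ m M+N≤m → *-cancelˡ-≤ 2 (begin
      2 * (c * (f m + g m))          ≡⟨ eq c (f m) (g m) ⟩
      2 * c * f m + 2 * c * g m      ≤⟨ +-mono-≤ (leᶠ m (m+n≤o⇒m≤o M M+N≤m)) (leᵍ m (m+n≤o⇒n≤o M M+N≤m)) ⟩
      m + m                          ≡⟨ cong (m +_) (+-identityʳ m) ⟨
      2 * m                          ∎)
    where
    open ≤-Reasoning
    eq : ∀ c x y → 2 * (c * (x + y)) ≡ 2 * c * x + 2 * c * y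
    eq = solve-∀

  -- The geometric mean of `m` and an `o(m)` function is `o(m)`; the 4 is the loss in `∃√`.
  Sublinear-√ : ∀ {f g} → Sublinear g → (∀ m → f m * f m ≤ 4 * (m * g m)) → Sublinear f
  Sublinear-√ {f} {g} g-sub f²≤ c = let M , le = g-sub (4 * (c * c)) in M , λ m M≤m →
    m²≤n²⇒m≤n (begin
      c * f m * (c * f m)            ≡⟨ eq₁ c (f m) ⟩
      c * c * (f m * f m)            ≤⟨ *-monoʳ-≤ (c * c) (f²≤ m) ⟩
      c * c * (4 * (m * g m))        ≡⟨ eq₂ (c * c) m (g m) ⟩
      m * (4 * (c * c) * g m)        ≤⟨ *-monoʳ-≤ m (le m M≤m) ⟩
      m * m                          ∎)
    where
    open ≤-Reasoning
    eq₁ : ∀ c x → c * x * (c * x) ≡ c * c * (x * x)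
    eq₁ = solve-∀
    eq₂ : ∀ d m y → d * (4 * (m * y)) ≡ m * (4 * d * y)
    eq₂ = solve-∀

  -- From the moment inequality to the smaller count

  m²+n²≥2mn : ∀ m n → 2 * (m * n) ≤ m * m + n * n
  m²+n²≥2mn m n with ≤-total m n
  ... | inj₁ m≤n = subst (λ n → 2 * (m * n) ≤ m * m + n * n) (m+[n∸m]≡n m≤n) (shift m (n ∸ m))
    where
    shift : ∀ m d → 2 * (m * (m + d)) ≤ m * m + (m + d) * (m + d)
    shift m d = ≤-trans (m≤m+n _ (d * d)) (≤-reflexive (eq m d))
      where
      eq : ∀ m d → 2 * (m * (m + d)) + d * d ≡ m * m + (m + d) * (m + d)
      eq = solve-∀
  ... | inj₂ n≤m = subst (λ m → 2 * (m * n) ≤ m * m + n * n) (m+[n∸m]≡n n≤m) (shift n (m ∸ n))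
    where
    shift : ∀ n d → 2 * ((n + d) * n) ≤ (n + d) * (n + d) + n * n
    shift n d = ≤-trans (m≤m+n _ (d * d)) (≤-reflexive (eq n d))
      where
      eq : ∀ n d → 2 * ((n + d) * n) + d * d ≡ (n + d) * (n + d) + n * n
      eq = solve-∀

  [a-b]²≤f²⇒a≤b+f : ∀ a b f → a * a + b * b ≤ 2 * (a * b) + f * f → a ≤ b + f
  [a-b]²≤f²⇒a≤b+f a b f le = ≮⇒≥ λ b+f<a → absurd (a ∸ suc (b + f)) (sym (m+[n∸m]≡n b+f<a))
    where
    eq : ∀ b f j → (suc (b + f) + j) * (suc (b + f) + j) + b * b ≡
                   suc (2 * ((suc (b + f) + j) * b) + f * f + (f + f + j * j + 2 * j * suc f))
    eq = solve-∀
    absurd : ∀ j → a ≢ suc (b + f) + j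
    absurd j refl = <⇒≱ (≤-trans (s≤s (m≤m+n _ _)) (≤-reflexive (sym (eq b f j)))) le

  -- t = 1 + s balances the two error terms m K / t and √(m t).
  module Balance (m K R s f a b : ℕ) .{{_ : NonZero R}} (a≤m : a ≤ m) (b≤m : b ≤ m)
    (m≤s² : m ≤ s * s) (f-large : m * (K + suc s * (2 * R)) ≤ f * f)
    (moments : a * a + b * b + suc s * (2 * m) ≤
               2 * (a * b) + m * K + suc s * (R * (a + b))) where

    open ≤-Reasoning

    -- `s * K` covers the loss in the mean and `f` the gap between `a` and `b`; the 1 pays for the
    -- leaf level of the tree.
    e = s * K + f + 1

    difference : a * a + b * b ≤ 2 * (a * b) + f * f
    difference = begin
      a * a + b * b                                       ≤⟨ m≤m+n _ _ ⟩
      a * a + b * b + suc s * (2 * m)                     ≤⟨ moments ⟩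
      2 * (a * b) + m * K + suc s * (R * (a + b))
        ≤⟨ +-monoʳ-≤ (2 * (a * b) + m * K) (*-monoʳ-≤ (suc s) (*-monoʳ-≤ R (+-mono-≤ a≤m b≤m))) ⟩
      2 * (a * b) + m * K + suc s * (R * (m + m))         ≡⟨ eq (2 * (a * b)) m K s R ⟩
      2 * (a * b) + m * (K + suc s * (2 * R))             ≤⟨ +-monoʳ-≤ (2 * (a * b)) f-large ⟩
      2 * (a * b) + f * f                                 ∎
      where
      eq : ∀ x m K s R → x + m * K + suc s * (R * (m + m)) ≡ x + m * (K + suc s * (2 * R))
      eq = solve-∀

    2m≤sK+R[a+b] : 2 * m ≤ s * K + R * (a + b)
    -- The square `(a - b)²` is discarded and the weight divided out; it is `suc s` and not `s` so
    -- that this also works for `m = 0`.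
    2m≤sK+R[a+b] = *-cancelˡ-≤ (suc s) (+-cancelˡ-≤ (a * a + b * b) _ _ (begin
      a * a + b * b + suc s * (2 * m)                     ≤⟨ moments ⟩
      2 * (a * b) + m * K + suc s * (R * (a + b))
        -- `m K ≤ s² K ≤ (1 + s) (s K)` makes the weight a factor of this term too.
        ≤⟨ +-monoˡ-≤ _ (+-mono-≤ (m²+n²≥2mn a b) (≤-trans (*-monoˡ-≤ K m≤s²) (≤-trans
             (≤-reflexive (*-assoc s s K)) (m≤n+m _ (s * K))))) ⟩
      a * a + b * b + suc s * (s * K) + suc s * (R * (a + b))
        ≡⟨ eq (a * a + b * b) s (s * K) (R * (a + b)) ⟩
      a * a + b * b + suc s * (s * K + R * (a + b))       ∎))
      where
      eq : ∀ x s y z → x + suc s * y + suc s * z ≡ x + suc s * (y + z)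
      eq = solve-∀

    m+R≤R[e+b] : m + R ≤ R * (e + b)
    m+R≤R[e+b] = *-cancelˡ-≤ 2 (begin
      2 * (m + R)                                         ≡⟨ *-distribˡ-+ 2 m R ⟩
      2 * m + 2 * R                                       ≤⟨ +-monoˡ-≤ (2 * R) 2m≤sK+R[a+b] ⟩
      s * K + R * (a + b) + 2 * R
        ≤⟨ +-monoˡ-≤ (2 * R) (+-mono-≤ (m≤n*m (s * K) R)
             (*-monoʳ-≤ R (+-monoˡ-≤ b ([a-b]²≤f²⇒a≤b+f a b f difference)))) ⟩
      R * (s * K) + R * (b + f + b) + 2 * R               ≤⟨ m≤m+n _ (R * (s * K) + R * f) ⟩
      R * (s * K) + R * (b + f + b) + 2 * R + (R * (s * K) + R * f) ≡⟨ eq R (s * K) b f ⟩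
      2 * (R * (s * K + f + 1 + b))                       ∎)
      where
      eq : ∀ R x b f → R * x + R * (b + f + b) + 2 * R + (R * x + R * f) ≡ 2 * (R * (x + f + 1 + b))
      eq = solve-∀

  -- The moment inequality is symmetric in `a` and `b`, so either count can play the part of the
  -- smaller one.
  m+R≤R[e+a⊓b] : ∀ {m K R s f a b} .{{_ : NonZero R}} → a ≤ m → b ≤ m →
    m ≤ s * s → m * (K + suc s * (2 * R)) ≤ f * f →
    a * a + b * b + suc s * (2 * m) ≤ 2 * (a * b) + m * K + suc s * (R * (a + b)) →
    m + R ≤ R * (s * K + f + 1 + a ⊓ b)
  m+R≤R[e+a⊓b] {m} {K} {R} {s} {f} {a} {b} a≤m b≤m m≤s² f-large moments with ⊓-sel a b
  ... | inj₁ a⊓b≡a rewrite a⊓b≡a =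
    Balance.m+R≤R[e+b] m K R s f b a b≤m a≤m m≤s² f-large (subst₂ _≤_
      (cong (_+ suc s * (2 * m)) (+-comm (a * a) (b * b)))
      (cong₂ (λ p q → 2 * p + m * K + suc s * (R * q)) (*-comm a b) (+-comm a b))
      moments)
  ... | inj₂ a⊓b≡b rewrite a⊓b≡b = Balance.m+R≤R[e+b] m K R s f a b a≤m b≤m m≤s² f-large moments

  -- Adding `R * c` to both sides removes the truncated subtraction; the `R` next to `m` in the
  -- hypothesis is the `suc` of the depth.
  depth-bound : ∀ {m R e c} → c ≤ m → m + R ≤ R * (e + c) → R * (suc m ∸ c) + m ≤ R * (m + e)
  depth-bound {m} {R} {e} {c} c≤m le = +-cancelˡ-≤ (R * c) _ _ (begin
    R * c + (R * (suc m ∸ c) + m)    ≡⟨ eq₁ R c (suc m ∸ c) m ⟩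
    R * (c + (suc m ∸ c)) + m        ≡⟨ cong (λ x → R * x + m) (m+[n∸m]≡n (m≤n⇒m≤1+n c≤m)) ⟩
    R * suc m + m                    ≡⟨ eq₂ R m ⟩
    R * m + (m + R)                  ≤⟨ +-monoʳ-≤ (R * m) le ⟩
    R * m + R * (e + c)              ≡⟨ eq₃ R m e c ⟩
    R * c + R * (m + e)              ∎)
    where
    open ≤-Reasoning
    eq₁ : ∀ R c d m → R * c + (R * d + m) ≡ R * (c + d) + m
    eq₁ = solve-∀
    eq₂ : ∀ R m → R * suc m + m ≡ R * m + (m + R)
    eq₂ = solve-∀
    eq₃ : ∀ R m e c → R * m + R * (e + c) ≡ R * c + R * (m + e)
    eq₃ = solve-∀

open import Data.Nat using (ℕ; NonZero; _≤_; zero; suc; z≤n; _+_; _*_; _∸_; _^_; _⊓_; _<_)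
open import Data.Nat.Properties
open import Data.Nat.Tactic.RingSolver using (solve-∀)
open import Algebra.Properties.Semiring.Sum +-*-semiring using (sum)
open import Data.Product using (Σ-syntax; _×_; ∃-syntax; _,_; proj₁; proj₂)
open import Data.Fin.Subset using (∣_∣; ∁; _∩_)
open import Relation.Binary.PropositionalEquality using (_≡_)
open Combinatorics
open Reals using (size-bound; ∈o-fromℕ; ∈o-√⇒square)

-- The error term and the final assembly

module ErrorTerm (r : ℕ) (k : ℕ → ℕ) where

  R : ℕ
  R = 2 ^ r

  -- These depend on `m`, `r` and `k` alone, as the error must be uniform in `Ψ`. `m * variance m`
  -- bounds `(a - b)²` for the chosen colouring: `m * K m` is the second moment, the rest is the
  -- weighted `R (a + b)` with `a, b ≤ m`.
  K s variance f e : ℕ → ℕ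
  K m        = r * k m
  s m        = proj₁ (∃√ m)
  variance m = K m + suc (s m) * (2 * R)
  f m        = proj₁ (∃√ (m * variance m))
  e m        = s m * K m + f m + 1

  m≤m*m : ∀ m → m ≤ m * m
  m≤m*m zero    = z≤n
  m≤m*m (suc m) = m≤m+n (suc m) _

  -- `s m * K m` is of the order of the geometric mean of `m` and `K m * K m`, and the latter is
  -- `o(m)` by squaring the hypothesis on `k`. `f` is likewise a mean of `m` and `variance`.
  e-sublinear : k ∈o √_ → Sublinear e
  e-sublinear k-small =
    Sublinear-+ (Sublinear-+ sK-sublinear f-sublinear) (Sublinear-const 1)
    where
    open ≤-Reasoning

    K²-sublinear : Sublinear (λ m → K m * K m)
    K²-sublinear c = let M , le = ∈o-√⇒square k-small (c * r) in M , λ m M≤m → begin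
      c * (K m * K m)                  ≤⟨ *-monoˡ-≤ (K m * K m) (m≤m*m c) ⟩
      c * c * (K m * K m)              ≡⟨ eq c r (k m) ⟩
      c * r * k m * (c * r * k m)      ≤⟨ le m M≤m ⟩
      m                                ∎
      where
      eq : ∀ c r x → c * c * (r * x * (r * x)) ≡ c * r * x * (c * r * x)
      eq = solve-∀

    K-sublinear : Sublinear K
    K-sublinear c = let M , le = K²-sublinear c in
      M , λ m M≤m → ≤-trans (*-monoʳ-≤ c (m≤m*m (K m))) (le m M≤m)

    s-sublinear : Sublinear s
    s-sublinear = Sublinear-√ (Sublinear-const 1) λ m →
      ≤-trans (proj₂ (proj₂ (∃√ m))) (*-monoʳ-≤ 4 (≤-reflexive (m≡m*1 m)))
      where
      m≡m*1 : ∀ m → m ≡ m * 1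
      m≡m*1 = solve-∀

    sK-sublinear : Sublinear (λ m → s m * K m)
    sK-sublinear = Sublinear-√ K²-sublinear λ m → begin
      s m * K m * (s m * K m)          ≡⟨ eq₁ (s m) (K m) ⟩
      s m * s m * (K m * K m)          ≤⟨ *-monoˡ-≤ (K m * K m) (proj₂ (proj₂ (∃√ m))) ⟩
      4 * m * (K m * K m)              ≡⟨ *-assoc 4 m _ ⟩
      4 * (m * (K m * K m))            ∎
      where
      eq₁ : ∀ x y → x * y * (x * y) ≡ x * x * (y * y)
      eq₁ = solve-∀

    f-sublinear : Sublinear f
    f-sublinear = Sublinear-√
      (Sublinear-+ K-sublinear (Sublinear-* (2 * R) (Sublinear-+ (Sublinear-const 1) s-sublinear)))
      (λ m → proj₂ (proj₂ (∃√ (m * variance m))))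

  small-refutation : ∀ m (Ψ : CSP m (k m)) → Unsatisfiable Ψ → variableFrequency Ψ ≤ r →
                     ∃[ d ] (R * d + m ≤ R * (m + e m)) × Σ[ π ∈ TreeRefutation (cnf Ψ) ] size π < 2 ^ d
  small-refutation m Ψ unsat freq = fromSplit (Splitting.∃-balanced (mask Ψ) ∣mask∣≤r overlaps≤K (suc (s m)))
    where
    ∣mask∣≤r : ∀ x → ∣ mask Ψ x ∣ ≤ r
    ∣mask∣≤r x = ≤-trans (∣mask∣≤frequency Ψ x) freq

    overlaps≤K : ∀ x → sum (λ y → ∣ mask Ψ x ∩ mask Ψ y ∣) ≤ K m
    overlaps≤K x = ≤-trans (overlap≤ Ψ (mask Ψ x)) (*-monoˡ-≤ (k m) (∣mask∣≤r x))

    fromSplit : (∃[ χ ] countᴬ (mask Ψ) χ * countᴬ (mask Ψ) χ + countᴮ (mask Ψ) χ * countᴮ (mask Ψ) χ +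
                        suc (s m) * (2 * m) ≤
                        2 * (countᴬ (mask Ψ) χ * countᴮ (mask Ψ) χ) + m * K m +
                        suc (s m) * (R * (countᴬ (mask Ψ) χ + countᴮ (mask Ψ) χ))) →
                ∃[ d ] (R * d + m ≤ R * (m + e m)) × Σ[ π ∈ TreeRefutation (cnf Ψ) ] size π < 2 ^ d
    fromSplit (χ , moments) = suc m ∸ a ⊓ b ,
      depth-bound {R = R} {e = e m} (≤-trans (m⊓n≤m a b) a≤m)
        (m+R≤R[e+a⊓b] {m} {K m} {R} {s m} {f m} {a} {b} {{m^n≢0 2 r}} a≤m b≤m
          (proj₁ (proj₂ (∃√ m))) (proj₁ (proj₂ (∃√ (m * variance m)))) moments) ,
      refutation-of-split Ψ unsat χ (m⊓n≤m a b) (m⊓n≤n a b)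
      where
      a b : ℕ
      a = countᴬ (mask Ψ) χ
      b = countᴮ (mask Ψ) χ
      a≤m : a ≤ m
      a≤m = sum-bit≤ (λ x → within (mask Ψ x) χ)
      b≤m : b ≤ m
      b≤m = sum-bit≤ (λ x → within (mask Ψ x) (∁ χ))

theorem5p2 : (r : ℕ) .{{_ : NonZero r}} (k : ℕ → ℕ) → k ∈o √_ →
    Σ[ e ∈ (ℕ → ℕ) ] ((e ∈o fromℕ) ×
    (∀ m (Ψ : CSP m (k m)) → Unsatisfiable Ψ → variableFrequency Ψ ≤ r →
    Σ[ π ∈ TreeRefutation (cnf Ψ) ]
    (fromℕ (size π) ≤ᴿ 2^ ((fromℕ 1 -ᴿ ε r) *ᴿ fromℕ m +ᴿ fromℕ (e m)))))
theorem5p2 r k k-small = e , ∈o-fromℕ (e-sublinear k-small) , λ m Ψ unsat freq →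
  let d , d-bound , π , π< = small-refutation m Ψ unsat freq in
  π , size-bound r {m} {e m} {d} {size π} d-bound π<
  where open ErrorTerm r k
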